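{- Let $m\geqslant 1$, let $n_1,\ldots,n_{m}$ be positive integers, set $n_{m+1}=n_1$, and let $j,r$ be non-negative integers with $j\leqslant m$. Then, modulo $[n_1+n_m+1]{n_1+n_{m}\brack n_1}$, \begin{align*} &\sum_{k=0}^{n_1} q^{j(k^2+k)-(2r+1)k}[2k+1]^{2r+1}\prod_{i=1}^m {n_i+n_{i+1}+1\brack n_i-k}\equiv 0, \\ &\sum_{k=0}^{n_1}(-1)^k q^{{k\choose 2}+j(k^2+k)-2rk}[2k+1]^{2r+1}\prod_{i=1}^m {n_i+n_{i+1}+1\brack n_i-k} \equiv 0. \end{align*}
   Context: For a non-negative integer $n$, $[n]=1+q+\cdots+q^{n-1}$ is the $q$-integer. The $q$-binomial coefficient is ${n\brack k}=\prod_{i=1}^k\frac{1-q^{n-i+1}}{1-q^i}$ if $k\geqslant 0$ and ${n\brack k}=0$ if $k<0$. For a polynomial $D$ in $q$ and Laurent polynomials $A,B$ in $q$, $A\equiv B \bmod D$ means that $(A-B)/D$ is a Laurent polynomial in $q$. -}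

module Defs where

open import Data.Nat as ℕ using (ℕ; zero; suc; _⊔_; _∸_)
open import Data.Integer as ℤ using (ℤ; +_; -[1+_])
open import Data.List using (List; []; _∷_; replicate; _++_; length; drop)
open import Data.Product using (Σ; _,_; _×_)
open import Relation.Binary.PropositionalEquality using (_≡_)

-- Polynomials: coefficient lists, lowest degree first.

Poly : Set
Poly = List ℤ

coeff : Poly → ℕ → ℤ
coeff []       _       = + 0
coeff (a ∷ p)  zero    = a
coeff (a ∷ p)  (suc i) = coeff p i

infix 4 _≈ₚ_
_≈ₚ_ : Poly → Poly → Set
p ≈ₚ r = ∀ i → coeff p i ≡ coeff r i

infixl 6 _+ₚ_ _-ₚ_
infixl 7 _*ₚ_

_+ₚ_ : Poly → Poly → Poly
[]      +ₚ r       = r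
(a ∷ p) +ₚ []      = a ∷ p
(a ∷ p) +ₚ (b ∷ r) = (a ℤ.+ b) ∷ (p +ₚ r)

scaleₚ : ℤ → Poly → Poly
scaleₚ c []      = []
scaleₚ c (a ∷ p) = (c ℤ.* a) ∷ scaleₚ c p

negₚ : Poly → Poly
negₚ = scaleₚ (ℤ.- (+ 1))

_-ₚ_ : Poly → Poly → Poly
p -ₚ r = p +ₚ negₚ r

_*ₚ_ : Poly → Poly → Poly
[]      *ₚ r = []
(a ∷ p) *ₚ r = scaleₚ a r +ₚ (+ 0 ∷ (p *ₚ r))

shiftₚ : ℕ → Poly → Poly
shiftₚ n p = replicate n (+ 0) ++ p

oneₚ : Poly
oneₚ = + 1 ∷ []

qpow : ℕ → Poly
qpow n = shiftₚ n oneₚ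

_^ₚ_ : Poly → ℕ → Poly
p ^ₚ zero  = oneₚ
p ^ₚ suc n = p *ₚ (p ^ₚ n)

prodₚ : ℕ → (ℕ → Poly) → Poly
prodₚ zero    f = oneₚ
prodₚ (suc k) f = prodₚ k f *ₚ f (suc k)

-- Exact division by a polynomial with constant term 1
-- (low-order long division, i.e. power-series division, run long enough
--  to produce every coefficient of the quotient when the division is exact).

divLow : ℕ → Poly → Poly → Poly
divLow zero    a b = []
divLow (suc f) a b = c ∷ divLow f (drop 1 (a -ₚ scaleₚ c b)) b
  where c = coeff a 0

divₚ : Poly → Poly → Poly
divₚ a b = divLow (length a) a b

qint : ℕ → Poly
qint n = replicate n (+ 1)

oneMinusQ : ℕ → Poly
oneMinusQ m = oneₚ -ₚ qpow m

-- [n brack k] = ∏_{i=1}^k (1 - q^{n-i+1}) / (1 - q^i)   (k ≥ 0)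
-- (for i ≤ n+1 the exponent n-i+1 equals (suc n) ∸ i; once i = n+1 the
--  numerator has the factor 1 - q^0 = 0, so ℕ-truncation is harmless)
qbinom : ℕ → ℕ → Poly
qbinom n k = divₚ (prodₚ k (λ i → oneMinusQ (suc n ∸ i)))
                  (prodₚ k (λ i → oneMinusQ i))

qbinomℤ : ℕ → ℤ → Poly
qbinomℤ n (+ k)    = qbinom n k
qbinomℤ n -[1+ k ] = []

-- Laurent polynomials: (s , p) stands for q^{-s} · p

Laurent : Set
Laurent = ℕ × Poly

fromPoly : Poly → Laurent
fromPoly p = (0 , p)

infixl 6 _+ₗ_
infixl 7 _*ₗ_

_+ₗ_ : Laurent → Laurent → Laurent
(s , p) +ₗ (t , r) = (s ⊔ t , shiftₚ ((s ⊔ t) ∸ s) p +ₚ shiftₚ ((s ⊔ t) ∸ t) r)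

_*ₗ_ : Laurent → Laurent → Laurent
(s , p) *ₗ (t , r) = (s ℕ.+ t , p *ₚ r)

zeroₗ : Laurent
zeroₗ = (0 , [])

qpowℤ : ℤ → Laurent
qpowℤ (+ n)    = (0 , qpow n)
qpowℤ -[1+ n ] = (suc n , oneₚ)

scaleₗ : ℤ → Laurent → Laurent
scaleₗ c (s , p) = (s , scaleₚ c p)

sumₗ : ℕ → (ℕ → Laurent) → Laurent
sumₗ zero    f = f 0
sumₗ (suc n) f = sumₗ n f +ₗ f (suc n)

-- Congruence modulo a polynomial D:
-- A ≡ B (mod D) iff (A - B)/D is a Laurent polynomial, i.e. there is a
-- Laurent polynomial L = q^{-t}·P with A - B = D · L.
-- Writing A - B = q^{-s}·p, this reads q^t · p = q^s · (D · P).

_≡0mod_ : Laurent → Poly → Set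
(s , p) ≡0mod D = Σ ℕ λ t → Σ Poly λ P → shiftₚ t p ≈ₚ shiftₚ s (D *ₚ P)

_≡_mod_ : Laurent → Laurent → Poly → Set
A ≡ B mod D = (A +ₗ scaleₗ (ℤ.- (+ 1)) B) ≡0mod D

{-# OPTIONS --safe #-}
-- Write β a b k for the q-binomial coefficient with entries a + b + 1 and a - k, and M a b for the modulus.
-- Call a weight w good if, for m = 1, the sum of w k * β n n k over k is divisible by M n n for every n.
-- The weights q^(-k) [2k+1] and (-1)^k q^(k choose 2) [2k+1] are good, since their sums telescope.
-- Since q^(-k) [k][k+1] = q^(-n) ([n][n+1] - [n-k][n+k+1]), and the last product lowers n in β n n k by one,
-- good weights are closed under multiplication by q^(-k) [k][k+1], of which q^(-2k) [2k+1]^2 is a polynomial.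
-- A limiting case of q-Vandermonde shows that they are closed under multiplication by q^(k^2+k) as well.
-- Finally q-Vandermonde writes a product β a b k * β b d k * β f a k as a combination of the β s d k * β f s k
-- with coefficients independent of k, which reduces cyclic products of length m to length m - 1.
module Submission where

open import Defs
open import Level using (_⊔_)
open import Data.Nat as ℕ using (ℕ; zero; suc; _∸_; _≤_; _<_; z≤n; s≤s)
import Data.Nat.Properties as ℕₚ
import Data.Nat.Solver
open import Data.Nat.Combinatorics using (_C_; nCk+nC[k+1]≡[n+1]C[k+1]; nC1≡n)
open import Data.Integer as ℤ using (ℤ; +_)
import Data.Integer.Properties as ℤₚ
open import Data.List using ([]; _∷_; length; drop; replicate)
import Data.List.Properties as Listₚ
open import Data.Maybe using (Maybe; just; nothing)
open import Data.Product using (_,_; _×_; ∃; proj₁; proj₂)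
open import Data.Sum using (inj₁; inj₂)
open import Relation.Nullary using (yes; no)
open import Relation.Binary.PropositionalEquality as ≡ using (_≡_; refl; cong; cong₂)
open import Relation.Binary.Bundles using (Setoid)
import Relation.Binary.Reasoning.Setoid as SetoidReasoning
open import Algebra.Bundles using (CommutativeRing)
open import Algebra.Solver.Ring.AlmostCommutativeRing using (_-Raw-AlmostCommutative⟶_; fromCommutativeRing)
import Algebra.Solver.Ring
import Algebra.Properties.Ring
import Algebra.Properties.CommutativeSemiring.Exp as Exp

-- Integer polynomials as a commutative ring

-- The expansions replace a free entry a by a smaller s, so the inner sum is divisible only by a
-- modulus that depends on s. Hence goodness is demanded for all n at once, and everything turns on
-- the fact that the coefficients of each expansion contain exactly the factor that raises the inner
-- modulus to the outer one (`β-M`, `M-ψ`). The scheme resembles the Bailey lemma: a weight summed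
-- against the kernel `β s s k` plays the part of a Bailey pair. All powers of q^(k^2+k) and of
-- [2k+1] are absorbed at m = 1, before any product is built. Two choices keep divisions and
-- negative powers out. Quotients of q-factorials are compared after multiplication by `φ`, whose
-- factors can be cancelled. A weight with q^(-ek) is multiplied by q^(en), which leaves a
-- polynomial since k ≤ n, and which fits the expansions because e(a-k) = e(a-s) + e(s-k).

module PolynomialRing where
  -- A record rather than _≈ₚ_ itself, so that the polynomials can be inferred from the type of a proof.
  infix 4 _≋_
  record _≋_ (p r : Poly) : Set where
    constructor mk
    field at : p ≈ₚ r
  open _≋_ public

  coeff-+ₚ : ∀ p r i → coeff (p +ₚ r) i ≡ coeff p i ℤ.+ coeff r i
  coeff-+ₚ []      r       i       = ≡.sym (ℤₚ.+-identityˡ _)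
  coeff-+ₚ (a ∷ p) []      i       = ≡.sym (ℤₚ.+-identityʳ _)
  coeff-+ₚ (a ∷ p) (b ∷ r) zero    = refl
  coeff-+ₚ (a ∷ p) (b ∷ r) (suc i) = coeff-+ₚ p r i

  coeff-scaleₚ : ∀ c p i → coeff (scaleₚ c p) i ≡ c ℤ.* coeff p i
  coeff-scaleₚ c []      i       = ≡.sym (ℤₚ.*-zeroʳ c)
  coeff-scaleₚ c (a ∷ p) zero    = refl
  coeff-scaleₚ c (a ∷ p) (suc i) = coeff-scaleₚ c p i

  polySetoid : Setoid _ _
  polySetoid = record
    { Carrier = Poly
    ; _≈_ = _≋_
    ; isEquivalence = record
      { refl  = mk λ i → refl
      ; sym   = λ e → mk λ i → ≡.sym (at e i)
      ; trans = λ e f → mk λ i → ≡.trans (at e i) (at f i)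
      }
    }

  private
    module S = Setoid polySetoid
  open SetoidReasoning polySetoid

  ∷-cong : ∀ {a b p r} → a ≡ b → p ≋ r → (a ∷ p) ≋ (b ∷ r)
  ∷-cong a≡b p≋r = mk λ { zero → a≡b ; (suc i) → at p≋r i }

  0∷[]≋[] : (+ 0 ∷ []) ≋ []
  0∷[]≋[] = mk λ { zero → refl ; (suc i) → refl }

  tail-≋ : ∀ {a b p r} → (a ∷ p) ≋ (b ∷ r) → p ≋ r
  tail-≋ e = mk λ i → at e (suc i)

  tail-≋[] : ∀ {a p} → (a ∷ p) ≋ [] → p ≋ []
  tail-≋[] e = mk λ i → at e (suc i)

  +ₚ-cong : ∀ {p p′ r r′} → p ≋ p′ → r ≋ r′ → p +ₚ r ≋ p′ +ₚ r′
  +ₚ-cong {p} {p′} {r} {r′} e f = mk λ i →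
    ≡.trans (coeff-+ₚ p r i) (≡.trans (cong₂ ℤ._+_ (at e i) (at f i)) (≡.sym (coeff-+ₚ p′ r′ i)))

  scaleₚ-cong : ∀ {c d p r} → c ≡ d → p ≋ r → scaleₚ c p ≋ scaleₚ d r
  scaleₚ-cong {c} {d} {p} {r} c≡d e = mk λ i →
    ≡.trans (coeff-scaleₚ c p i) (≡.trans (cong₂ ℤ._*_ c≡d (at e i)) (≡.sym (coeff-scaleₚ d r i)))

  +ₚ-assoc : ∀ p r s → (p +ₚ r) +ₚ s ≋ p +ₚ (r +ₚ s)
  +ₚ-assoc p r s = mk λ i → ≡.trans (coeff-+ₚ (p +ₚ r) s i) (≡.trans (cong (ℤ._+ coeff s i) (coeff-+ₚ p r i))
    (≡.trans (ℤₚ.+-assoc (coeff p i) (coeff r i) (coeff s i))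
    (≡.sym (≡.trans (coeff-+ₚ p (r +ₚ s) i) (cong (ℤ._+_ (coeff p i)) (coeff-+ₚ r s i))))))

  +ₚ-comm : ∀ p r → p +ₚ r ≋ r +ₚ p
  +ₚ-comm p r = mk λ i → ≡.trans (coeff-+ₚ p r i) (≡.trans (ℤₚ.+-comm (coeff p i) (coeff r i)) (≡.sym (coeff-+ₚ r p i)))

  +ₚ-identityʳ : ∀ p → p +ₚ [] ≋ p
  +ₚ-identityʳ p = +ₚ-comm p []

  +ₚ-inverseˡ : ∀ p → negₚ p +ₚ p ≋ []
  +ₚ-inverseˡ p = mk λ i → ≡.trans (coeff-+ₚ (negₚ p) p i)
    (≡.trans (cong (ℤ._+ coeff p i) (≡.trans (coeff-scaleₚ _ p i) (ℤₚ.-1*i≡-i (coeff p i)))) (ℤₚ.+-inverseˡ (coeff p i)))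

  +ₚ-interchange : ∀ p r s t → (p +ₚ r) +ₚ (s +ₚ t) ≋ (p +ₚ s) +ₚ (r +ₚ t)
  +ₚ-interchange p r s t = begin
    (p +ₚ r) +ₚ (s +ₚ t)  ≈⟨ +ₚ-assoc p r (s +ₚ t) ⟩
    p +ₚ (r +ₚ (s +ₚ t))  ≈⟨ +ₚ-cong (S.refl {p}) (+ₚ-assoc r s t) ⟨
    p +ₚ ((r +ₚ s) +ₚ t)  ≈⟨ +ₚ-cong (S.refl {p}) (+ₚ-cong (+ₚ-comm r s) S.refl) ⟩
    p +ₚ ((s +ₚ r) +ₚ t)  ≈⟨ +ₚ-cong (S.refl {p}) (+ₚ-assoc s r t) ⟩
    p +ₚ (s +ₚ (r +ₚ t))  ≈⟨ +ₚ-assoc p s (r +ₚ t) ⟨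
    (p +ₚ s) +ₚ (r +ₚ t)  ∎

  scaleₚ-distribˡ : ∀ c p r → scaleₚ c (p +ₚ r) ≋ scaleₚ c p +ₚ scaleₚ c r
  scaleₚ-distribˡ c p r = mk λ i → ≡.trans (coeff-scaleₚ c (p +ₚ r) i)
    (≡.trans (cong (ℤ._*_ c) (coeff-+ₚ p r i))
    (≡.trans (ℤₚ.*-distribˡ-+ c (coeff p i) (coeff r i))
    (≡.sym (≡.trans (coeff-+ₚ (scaleₚ c p) (scaleₚ c r) i) (cong₂ ℤ._+_ (coeff-scaleₚ c p i) (coeff-scaleₚ c r i))))))

  scaleₚ-distribʳ : ∀ c d p → scaleₚ (c ℤ.+ d) p ≋ scaleₚ c p +ₚ scaleₚ d p
  scaleₚ-distribʳ c d p = mk λ i → ≡.trans (coeff-scaleₚ (c ℤ.+ d) p i)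
    (≡.trans (ℤₚ.*-distribʳ-+ (coeff p i) c d)
    (≡.sym (≡.trans (coeff-+ₚ (scaleₚ c p) (scaleₚ d p) i) (cong₂ ℤ._+_ (coeff-scaleₚ c p i) (coeff-scaleₚ d p i)))))

  scaleₚ-assoc : ∀ c d p → scaleₚ (c ℤ.* d) p ≋ scaleₚ c (scaleₚ d p)
  scaleₚ-assoc c d p = mk λ i → ≡.trans (coeff-scaleₚ (c ℤ.* d) p i) (≡.trans (ℤₚ.*-assoc c d (coeff p i))
    (≡.sym (≡.trans (coeff-scaleₚ c (scaleₚ d p) i) (cong (ℤ._*_ c) (coeff-scaleₚ d p i)))))

  scaleₚ-zero : ∀ p → scaleₚ (+ 0) p ≋ []
  scaleₚ-zero p = mk λ i → coeff-scaleₚ (+ 0) p i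

  scaleₚ-one : ∀ p → scaleₚ (+ 1) p ≋ p
  scaleₚ-one p = mk λ i → ≡.trans (coeff-scaleₚ (+ 1) p i) (ℤₚ.*-identityˡ _)

  0∷-*ₚ : ∀ p r → (+ 0 ∷ p) *ₚ r ≋ (+ 0 ∷ (p *ₚ r))
  0∷-*ₚ p r = +ₚ-cong (scaleₚ-zero r) S.refl

  scaleₚ-0∷ : ∀ c p → scaleₚ c (+ 0 ∷ p) ≋ (+ 0 ∷ scaleₚ c p)
  scaleₚ-0∷ c p = ∷-cong (ℤₚ.*-zeroʳ c) S.refl

  *ₚ-congˡ : ∀ p {r s} → r ≋ s → p *ₚ r ≋ p *ₚ s
  *ₚ-congˡ []      e = S.refl
  *ₚ-congˡ (a ∷ p) e = +ₚ-cong (scaleₚ-cong refl e) (∷-cong refl (*ₚ-congˡ p e))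

  *ₚ-zeroˡ : ∀ p {r} → p ≋ [] → p *ₚ r ≋ []
  *ₚ-zeroˡ []          e = S.refl
  *ₚ-zeroˡ (a ∷ p) {r} e = begin
    scaleₚ a r +ₚ (+ 0 ∷ (p *ₚ r)) ≈⟨ +ₚ-cong (scaleₚ-cong (at e 0) S.refl) (∷-cong refl (*ₚ-zeroˡ p (tail-≋[] e))) ⟩
    scaleₚ (+ 0) r +ₚ (+ 0 ∷ [])   ≈⟨ +ₚ-cong (scaleₚ-zero r) 0∷[]≋[] ⟩
    []                             ∎

  *ₚ-congʳ : ∀ p p′ {r} → p ≋ p′ → p *ₚ r ≋ p′ *ₚ r
  *ₚ-congʳ []      p′       e = S.sym (*ₚ-zeroˡ p′ (S.sym e))
  *ₚ-congʳ (a ∷ p) []       e = *ₚ-zeroˡ (a ∷ p) e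
  *ₚ-congʳ (a ∷ p) (b ∷ p′) e = +ₚ-cong (scaleₚ-cong (at e 0) S.refl) (∷-cong refl (*ₚ-congʳ p p′ (tail-≋ e)))

  *ₚ-zeroʳ : ∀ p → p *ₚ [] ≋ []
  *ₚ-zeroʳ []      = S.refl
  *ₚ-zeroʳ (a ∷ p) = S.trans (∷-cong refl (*ₚ-zeroʳ p)) 0∷[]≋[]

  *ₚ-distribʳ : ∀ s p r → (p +ₚ r) *ₚ s ≋ p *ₚ s +ₚ r *ₚ s
  *ₚ-distribʳ s []      r       = S.refl
  *ₚ-distribʳ s (a ∷ p) []      = S.sym (+ₚ-identityʳ _)
  *ₚ-distribʳ s (a ∷ p) (b ∷ r) = begin
    scaleₚ (a ℤ.+ b) s +ₚ (+ 0 ∷ ((p +ₚ r) *ₚ s))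
      ≈⟨ +ₚ-cong (scaleₚ-distribʳ a b s) (∷-cong refl (*ₚ-distribʳ s p r)) ⟩
    (scaleₚ a s +ₚ scaleₚ b s) +ₚ ((+ 0 ∷ (p *ₚ s)) +ₚ (+ 0 ∷ (r *ₚ s)))
      ≈⟨ +ₚ-interchange (scaleₚ a s) (scaleₚ b s) (+ 0 ∷ (p *ₚ s)) (+ 0 ∷ (r *ₚ s)) ⟩
    (scaleₚ a s +ₚ (+ 0 ∷ (p *ₚ s))) +ₚ (scaleₚ b s +ₚ (+ 0 ∷ (r *ₚ s))) ∎

  *ₚ-∷ : ∀ p b r → p *ₚ (b ∷ r) ≋ scaleₚ b p +ₚ (+ 0 ∷ (p *ₚ r))
  *ₚ-∷ []      b r = S.sym 0∷[]≋[]
  *ₚ-∷ (a ∷ p) b r = ∷-cong (cong (ℤ._+ + 0) (ℤₚ.*-comm a b)) (begin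
    scaleₚ a r +ₚ p *ₚ (b ∷ r)                    ≈⟨ +ₚ-cong S.refl (*ₚ-∷ p b r) ⟩
    scaleₚ a r +ₚ (scaleₚ b p +ₚ (+ 0 ∷ (p *ₚ r))) ≈⟨ +ₚ-assoc (scaleₚ a r) (scaleₚ b p) _ ⟨
    (scaleₚ a r +ₚ scaleₚ b p) +ₚ (+ 0 ∷ (p *ₚ r)) ≈⟨ +ₚ-cong (+ₚ-comm (scaleₚ a r) (scaleₚ b p)) S.refl ⟩
    (scaleₚ b p +ₚ scaleₚ a r) +ₚ (+ 0 ∷ (p *ₚ r)) ≈⟨ +ₚ-assoc (scaleₚ b p) (scaleₚ a r) _ ⟩
    scaleₚ b p +ₚ (scaleₚ a r +ₚ (+ 0 ∷ (p *ₚ r))) ∎)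

  *ₚ-comm : ∀ p r → p *ₚ r ≋ r *ₚ p
  *ₚ-comm []      r = S.sym (*ₚ-zeroʳ r)
  *ₚ-comm (a ∷ p) r = S.trans (+ₚ-cong S.refl (∷-cong refl (*ₚ-comm p r))) (S.sym (*ₚ-∷ r a p))

  scaleₚ-*ₚ : ∀ c p r → scaleₚ c p *ₚ r ≋ scaleₚ c (p *ₚ r)
  scaleₚ-*ₚ c []      r = S.refl
  scaleₚ-*ₚ c (a ∷ p) r = begin
    scaleₚ (c ℤ.* a) r +ₚ (+ 0 ∷ (scaleₚ c p *ₚ r))
      ≈⟨ +ₚ-cong (scaleₚ-assoc c a r) (∷-cong refl (scaleₚ-*ₚ c p r)) ⟩
    scaleₚ c (scaleₚ a r) +ₚ (+ 0 ∷ scaleₚ c (p *ₚ r))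
      ≈⟨ +ₚ-cong S.refl (scaleₚ-0∷ c (p *ₚ r)) ⟨
    scaleₚ c (scaleₚ a r) +ₚ scaleₚ c (+ 0 ∷ (p *ₚ r))
      ≈⟨ scaleₚ-distribˡ c (scaleₚ a r) (+ 0 ∷ (p *ₚ r)) ⟨
    scaleₚ c (scaleₚ a r +ₚ (+ 0 ∷ (p *ₚ r))) ∎

  *ₚ-assoc : ∀ p r s → (p *ₚ r) *ₚ s ≋ p *ₚ (r *ₚ s)
  *ₚ-assoc []      r s = S.refl
  *ₚ-assoc (a ∷ p) r s = begin
    (scaleₚ a r +ₚ (+ 0 ∷ (p *ₚ r))) *ₚ s        ≈⟨ *ₚ-distribʳ s (scaleₚ a r) (+ 0 ∷ (p *ₚ r)) ⟩
    scaleₚ a r *ₚ s +ₚ (+ 0 ∷ (p *ₚ r)) *ₚ s     ≈⟨ +ₚ-cong (scaleₚ-*ₚ a r s) (0∷-*ₚ (p *ₚ r) s) ⟩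
    scaleₚ a (r *ₚ s) +ₚ (+ 0 ∷ ((p *ₚ r) *ₚ s)) ≈⟨ +ₚ-cong S.refl (∷-cong refl (*ₚ-assoc p r s)) ⟩
    scaleₚ a (r *ₚ s) +ₚ (+ 0 ∷ (p *ₚ (r *ₚ s))) ∎

  const-*ₚ : ∀ c p → (c ∷ []) *ₚ p ≋ scaleₚ c p
  const-*ₚ c p = S.trans (+ₚ-cong S.refl 0∷[]≋[]) (+ₚ-identityʳ _)

  *ₚ-identityˡ : ∀ p → oneₚ *ₚ p ≋ p
  *ₚ-identityˡ p = S.trans (const-*ₚ (+ 1) p) (scaleₚ-one p)

  polyRing : CommutativeRing _ _
  polyRing = record
    { Carrier = Poly
    ; _≈_ = _≋_
    ; _+_ = _+ₚ_
    ; _*_ = _*ₚ_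
    ; -_  = negₚ
    ; 0#  = []
    ; 1#  = oneₚ
    ; isCommutativeRing = record
      { isRing = record
        { +-isAbelianGroup = record
          { isGroup = record
            { isMonoid = record
              { isSemigroup = record
                { isMagma = record { isEquivalence = S.isEquivalence ; ∙-cong = +ₚ-cong }
                ; assoc = +ₚ-assoc
                }
              ; identity = (λ p → S.refl) , +ₚ-identityʳ
              }
            ; inverse = +ₚ-inverseˡ , λ p → S.trans (+ₚ-comm p (negₚ p)) (+ₚ-inverseˡ p)
            ; ⁻¹-cong = scaleₚ-cong refl
            }
          ; comm = +ₚ-comm
          }
        ; *-cong = λ {p} {p′} {r} {r′} e f → S.trans (*ₚ-congʳ p p′ e) (*ₚ-congˡ p′ f)
        ; *-assoc = *ₚ-assoc
        ; *-identity = *ₚ-identityˡ , λ p → S.trans (*ₚ-comm p oneₚ) (*ₚ-identityˡ p)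
        ; distrib = (λ p r s → S.trans (*ₚ-comm p (r +ₚ s)) (S.trans (*ₚ-distribʳ p r s) (+ₚ-cong (*ₚ-comm r p) (*ₚ-comm s p)))) , *ₚ-distribʳ
        }
      ; *-comm = *ₚ-comm
      }
    }

-- q-series over a commutative ring in which each 1 - q^n with n > 0 is cancellable

module _ {c ℓ} (R : CommutativeRing c ℓ) where
  open CommutativeRing R
  open Exp commutativeSemiring

  -- A substitute for dividing by q-factorials: identities between quotients are cross-multiplied
  -- and the factors 1 - q^n cancelled afterwards, so no fraction field is involved.
  Cancels-1-q^ : Carrier → Set (c ⊔ ℓ)
  Cancels-1-q^ q = ∀ n {x y} → (1# - q ^ suc n) * x ≈ (1# - q ^ suc n) * y → x ≈ y

module QSeries
  {c ℓ} (R : CommutativeRing c ℓ)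
  (ι : ℤ.+-*-rawRing -Raw-AlmostCommutative⟶ fromCommutativeRing R)
  (q : CommutativeRing.Carrier R)
  (1-q^-cancel : Cancels-1-q^ R q)
  where

  open CommutativeRing R renaming (refl to ≈-refl; sym to ≈-sym; trans to ≈-trans)
  open Exp commutativeSemiring

  open SetoidReasoning setoid

  private
    module ι = _-Raw-AlmostCommutative⟶_ ι

    -- Agrees with ι, but sends 0 and 1 to 0# and 1# on the nose, as the solver needs.
    ⟦_⟧ : ℤ → Carrier
    ⟦ + 0 ⟧ = 0#
    ⟦ + 1 ⟧ = 1#
    ⟦ i   ⟧ = ι.⟦ i ⟧

    ⟦⟧≈ι : ∀ i → ⟦ i ⟧ ≈ ι.⟦ i ⟧
    ⟦⟧≈ι (+ 0)           = ≈-sym ι.0-homo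
    ⟦⟧≈ι (+ 1)           = ≈-sym ι.1-homo
    ⟦⟧≈ι (+ suc (suc n)) = ≈-refl
    ⟦⟧≈ι ℤ.-[1+ n ]      = ≈-refl

    morphism : ℤ.+-*-rawRing -Raw-AlmostCommutative⟶ fromCommutativeRing R
    morphism = record
      { ⟦_⟧    = ⟦_⟧
      ; +-homo = λ i j → ≈-trans (⟦⟧≈ι (i ℤ.+ j)) (≈-trans (ι.+-homo i j) (≈-sym (+-cong (⟦⟧≈ι i) (⟦⟧≈ι j))))
      ; *-homo = λ i j → ≈-trans (⟦⟧≈ι (i ℤ.* j)) (≈-trans (ι.*-homo i j) (≈-sym (*-cong (⟦⟧≈ι i) (⟦⟧≈ι j))))
      ; -‿homo = λ i → ≈-trans (⟦⟧≈ι (ℤ.- i)) (≈-trans (ι.-‿homo i) (≈-sym (-‿cong (⟦⟧≈ι i))))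
      ; 0-homo = ≈-refl
      ; 1-homo = ≈-refl
      }

    _coeff≟_ : ∀ i j → Maybe (⟦ i ⟧ ≈ ⟦ j ⟧)
    i coeff≟ j with i ℤ.≟ j
    ... | yes refl = just ≈-refl
    ... | no _     = nothing

  open Algebra.Solver.Ring ℤ.+-*-rawRing (fromCommutativeRing R) morphism _coeff≟_
    using (solve; _:=_; con; _:+_; _:*_; _:-_; :-_; Polynomial)

  open Data.Nat.Solver.+-*-Solver
    using () renaming (solve to solveℕ; _:=_ to infix 4 _⊜_; _:+_ to infixl 6 _⊕_; _:*_ to infixl 7 _⊗_; con to con′)

  private
    :1 : ∀ {n} → Polynomial n
    :1 = con (+ 1)
    :0 : ∀ {n} → Polynomial n
    :0 = con (+ 0)

  zeroˡ′ : ∀ {x y} → x ≈ 0# → x * y ≈ 0#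
  zeroˡ′ e = ≈-trans (*-congʳ e) (zeroˡ _)

  zeroʳ′ : ∀ {x y} → y ≈ 0# → x * y ≈ 0#
  zeroʳ′ e = ≈-trans (*-congˡ e) (zeroʳ _)

  q^-+ : ∀ m n → q ^ (m ℕ.+ n) ≈ q ^ m * q ^ n
  q^-+ = ^-homo-* q

  q^-≡ : ∀ {m n} → m ≡ n → q ^ m ≈ q ^ n
  q^-≡ = ^-congʳ q

  -- Finite sums

  Σ≤ : ℕ → (ℕ → Carrier) → Carrier
  Σ≤ zero    f = f 0
  Σ≤ (suc n) f = Σ≤ n f + f (suc n)

  Σ-cong : ∀ n {f g} → (∀ k → k ≤ n → f k ≈ g k) → Σ≤ n f ≈ Σ≤ n g
  Σ-cong zero    e = e 0 z≤n
  Σ-cong (suc n) e = +-cong (Σ-cong n λ k k≤n → e k (ℕₚ.m≤n⇒m≤1+n k≤n)) (e (suc n) ℕₚ.≤-refl)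

  Σ-zero : ∀ n {f} → (∀ k → k ≤ n → f k ≈ 0#) → Σ≤ n f ≈ 0#
  Σ-zero zero    e = e 0 z≤n
  Σ-zero (suc n) e = ≈-trans (+-cong (Σ-zero n λ k k≤n → e k (ℕₚ.m≤n⇒m≤1+n k≤n)) (e (suc n) ℕₚ.≤-refl)) (+-identityˡ 0#)

  Σ-+ : ∀ n f g → Σ≤ n (λ k → f k + g k) ≈ Σ≤ n f + Σ≤ n g
  Σ-+ zero    f g = ≈-refl
  Σ-+ (suc n) f g = ≈-trans (+-congʳ (Σ-+ n f g))
    (solve 4 (λ a b x y → (a :+ b) :+ (x :+ y) := (a :+ x) :+ (b :+ y)) ≈-refl _ _ _ _)

  Σ-*ˡ : ∀ n x f → Σ≤ n (λ k → x * f k) ≈ x * Σ≤ n f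
  Σ-*ˡ zero    x f = ≈-refl
  Σ-*ˡ (suc n) x f = ≈-trans (+-congʳ (Σ-*ˡ n x f)) (≈-sym (distribˡ x _ _))

  Σ-swap : ∀ m n (f : ℕ → ℕ → Carrier) →
    Σ≤ m (λ i → Σ≤ n (λ j → f i j)) ≈ Σ≤ n (λ j → Σ≤ m (λ i → f i j))
  Σ-swap zero    n f = ≈-refl
  Σ-swap (suc m) n f = ≈-trans (+-congʳ (Σ-swap m n f)) (≈-sym (Σ-+ n _ _))

  Σ-truncate : ∀ {s a} f → s ≤ a → (∀ k → s < k → f k ≈ 0#) → Σ≤ a f ≈ Σ≤ s f
  Σ-truncate {s} {a} f s≤a e with ℕₚ.m≤n⇒m<n∨m≡n s≤a
  ... | inj₂ refl = ≈-refl
  Σ-truncate {s} {suc a} f s≤a e | inj₁ (s≤s s≤a′) =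
    ≈-trans (+-cong (Σ-truncate f s≤a′ e) (e (suc a) (s≤s s≤a′))) (+-identityʳ _)

  Σ-peel : ∀ n f → Σ≤ (suc n) f ≈ f 0 + Σ≤ n (λ k → f (suc k))
  Σ-peel zero    f = ≈-refl
  Σ-peel (suc n) f = ≈-trans (+-congʳ (Σ-peel n f)) (+-assoc _ _ _)

  Σ-drop : ∀ k x f → (∀ s → s < k → f s ≈ 0#) → Σ≤ (k ℕ.+ x) f ≈ Σ≤ x (λ u → f (k ℕ.+ u))
  Σ-drop zero    x f e = ≈-refl
  Σ-drop (suc k) x f e = begin
    Σ≤ (suc (k ℕ.+ x)) f                   ≈⟨ Σ-peel (k ℕ.+ x) f ⟩
    f 0 + Σ≤ (k ℕ.+ x) (λ u → f (suc u))   ≈⟨ +-cong (e 0 (s≤s z≤n)) (Σ-drop k x _ λ s s<k → e (suc s) (s≤s s<k)) ⟩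
    0# + Σ≤ x (λ u → f (suc k ℕ.+ u))      ≈⟨ +-identityˡ _ ⟩
    Σ≤ x (λ u → f (suc k ℕ.+ u))           ∎

  -- The hypothesis is f k - g k = h k - h (k+1) without subtraction. With g = 0 it evaluates a sum,
  -- as in the base cases; with a general g it identifies two sums, as in the Vandermonde
  -- identities.
  Σ-telescope : ∀ n (f g h : ℕ → Carrier) → (∀ k → k ≤ n → f k + h (suc k) ≈ g k + h k) →
    Σ≤ n f + h (suc n) ≈ Σ≤ n g + h 0
  Σ-telescope zero    f g h e = e 0 z≤n
  Σ-telescope (suc n) f g h e = begin
    (Σ≤ n f + f (suc n)) + h (suc (suc n))  ≈⟨ +-assoc _ _ _ ⟩
    Σ≤ n f + (f (suc n) + h (suc (suc n)))  ≈⟨ +-congˡ (e (suc n) ℕₚ.≤-refl) ⟩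
    Σ≤ n f + (g (suc n) + h (suc n))        ≈⟨ solve 3 (λ a b x → a :+ (b :+ x) := (a :+ x) :+ b) ≈-refl _ _ _ ⟩
    (Σ≤ n f + h (suc n)) + g (suc n)        ≈⟨ +-congʳ (Σ-telescope n f g h λ k k≤n → e k (ℕₚ.m≤n⇒m≤1+n k≤n)) ⟩
    (Σ≤ n g + h 0) + g (suc n)              ≈⟨ solve 3 (λ a b x → (a :+ x) :+ b := (a :+ b) :+ x) ≈-refl _ _ _ ⟩
    (Σ≤ n g + g (suc n)) + h 0              ∎

  -- q-integers, q-factorials and q-binomial coefficients

  [_] : ℕ → Carrier
  [ zero  ] = 0#
  [ suc n ] = 1# + q * [ n ]

  1-q*[] : ∀ n → (1# - q) * [ n ] ≈ 1# - q ^ n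
  1-q*[] zero    = solve 1 (λ x → (:1 :- x) :* :0 := :1 :- :1) ≈-refl q
  1-q*[] (suc n) = begin
    (1# - q) * (1# + q * [ n ])       ≈⟨ solve 2 (λ x y → (:1 :- x) :* (:1 :+ x :* y) := (:1 :- x) :+ x :* ((:1 :- x) :* y)) ≈-refl q [ n ] ⟩
    (1# - q) + q * ((1# - q) * [ n ]) ≈⟨ +-congˡ (*-congˡ (1-q*[] n)) ⟩
    (1# - q) + q * (1# - q ^ n)       ≈⟨ solve 2 (λ x y → (:1 :- x) :+ x :* (:1 :- y) := :1 :- x :* y) ≈-refl q (q ^ n) ⟩
    1# - q ^ suc n                    ∎

  1-q-cancel : ∀ {x y} → (1# - q) * x ≈ (1# - q) * y → x ≈ y
  1-q-cancel e = 1-q^-cancel 0 (≈-trans (*-congʳ q≈) (≈-trans e (*-congʳ (≈-sym q≈))))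
    where
    q≈ : 1# - q ^ 1 ≈ 1# - q
    q≈ = +-congˡ (-‿cong (*-identityʳ q))

  []-cancel : ∀ n {x y} → [ suc n ] * x ≈ [ suc n ] * y → x ≈ y
  []-cancel n {x} {y} e = 1-q^-cancel n (begin
    (1# - q ^ suc n) * x         ≈⟨ *-congʳ (1-q*[] (suc n)) ⟨
    (1# - q) * [ suc n ] * x     ≈⟨ *-assoc _ _ _ ⟩
    (1# - q) * ([ suc n ] * x)   ≈⟨ *-congˡ e ⟩
    (1# - q) * ([ suc n ] * y)   ≈⟨ *-assoc _ _ _ ⟨
    (1# - q) * [ suc n ] * y     ≈⟨ *-congʳ (1-q*[] (suc n)) ⟩
    (1# - q ^ suc n) * y         ∎)

  φ : ℕ → Carrier
  φ zero    = 1#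
  φ (suc n) = φ n * (1# - q ^ suc n)

  φ-cancel : ∀ n {x y} → φ n * x ≈ φ n * y → x ≈ y
  φ-cancel zero    e = ≈-trans (≈-sym (*-identityˡ _)) (≈-trans e (*-identityˡ _))
  φ-cancel (suc n) e = 1-q^-cancel n (φ-cancel n (≈-trans (≈-sym (*-assoc _ _ _)) (≈-trans e (*-assoc _ _ _))))

  -- G a b is the q-binomial coefficient with upper entry a + b and lower entry a.
  G : ℕ → ℕ → Carrier
  G zero    b       = 1#
  G (suc a) zero    = 1#
  G (suc a) (suc b) = G a (suc b) + q ^ suc a * G (suc a) b

  G-zeroʳ : ∀ a → G a 0 ≡ 1#
  G-zeroʳ zero    = refl
  G-zeroʳ (suc a) = refl

  -- The quotient formula in division-free form, and the bridge from the recursive `G` to all later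
  -- identities. Pascal's rule matches 1 - pr = (1-p) + p(1-r) for p = q^(a+1) and r = q^(b+1).
  G-φ : ∀ a b → G a b * (φ a * φ b) ≈ φ (a ℕ.+ b)
  G-φ zero    b       = solve 1 (λ x → :1 :* (:1 :* x) := x) ≈-refl (φ b)
  G-φ (suc a) zero    = ≈-trans (solve 1 (λ x → :1 :* (x :* :1) := x) ≈-refl (φ (suc a)))
    (reflexive (cong φ (≡.sym (ℕₚ.+-identityʳ (suc a)))))
  G-φ (suc a) (suc b) = begin
    (X + p * Y) * (φ a * (1# - p) * (φ b * (1# - r)))
      ≈⟨ solve 6 (λ X Y p r f g → (X :+ p :* Y) :* (f :* (:1 :- p) :* (g :* (:1 :- r)))
           := (:1 :- p) :* (X :* (f :* (g :* (:1 :- r)))) :+ p :* (:1 :- r) :* (Y :* (f :* (:1 :- p) :* g)))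
           ≈-refl X Y p r (φ a) (φ b) ⟩
    (1# - p) * (X * (φ a * φ (suc b))) + p * (1# - r) * (Y * (φ (suc a) * φ b))
      ≈⟨ +-cong (*-congˡ (G-φ a (suc b))) (*-congˡ (≈-trans (G-φ (suc a) b) (reflexive (cong φ (≡.sym (ℕₚ.+-suc a b)))))) ⟩
    (1# - p) * F + p * (1# - r) * F
      ≈⟨ solve 3 (λ p r F → (:1 :- p) :* F :+ p :* (:1 :- r) :* F := F :* (:1 :- p :* r)) ≈-refl p r F ⟩
    F * (1# - p * r)
      ≈⟨ *-congˡ (+-congˡ (-‿cong (q^-+ (suc a) (suc b)))) ⟨
    F * (1# - q ^ (suc a ℕ.+ suc b)) ∎
    where
    X = G a (suc b)
    Y = G (suc a) b
    p = q ^ suc a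
    r = q ^ suc b
    F = φ (a ℕ.+ suc b)

  φφ-cancel : ∀ a b {x y} → x * (φ a * φ b) ≈ y * (φ a * φ b) → x ≈ y
  φφ-cancel a b {x} {y} e = φ-cancel b (φ-cancel a (≈-trans (lemma x) (≈-trans e (≈-sym (lemma y)))))
    where
    lemma : ∀ z → φ a * (φ b * z) ≈ z * (φ a * φ b)
    lemma z = solve 3 (λ f g z → f :* (g :* z) := z :* (f :* g)) ≈-refl (φ a) (φ b) z

  G-sym : ∀ a b → G a b ≈ G b a
  G-sym a b = φφ-cancel a b (begin
    G a b * (φ a * φ b)  ≈⟨ G-φ a b ⟩
    φ (a ℕ.+ b)          ≡⟨ cong φ (ℕₚ.+-comm a b) ⟩
    φ (b ℕ.+ a)          ≈⟨ G-φ b a ⟨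
    G b a * (φ b * φ a)  ≈⟨ *-congˡ (*-comm _ _) ⟩
    G b a * (φ a * φ b)  ∎)

  -- Both sides are the q-trinomial coefficient φ(a+b+d) / (φ(a) φ(b) φ(d)).
  G-trinomial : ∀ a b d → G a b * G (a ℕ.+ b) d ≈ G a (b ℕ.+ d) * G b d
  G-trinomial a b d = φ-cancel a (φφ-cancel b d (begin
    φ a * (G a b * G (a ℕ.+ b) d) * (φ b * φ d)
      ≈⟨ solve 5 (λ A B D x y → A :* (x :* y) :* (B :* D) := y :* ((x :* (A :* B)) :* D)) ≈-refl (φ a) (φ b) (φ d) _ _ ⟩
    G (a ℕ.+ b) d * ((G a b * (φ a * φ b)) * φ d)
      ≈⟨ *-congˡ (*-congʳ (G-φ a b)) ⟩
    G (a ℕ.+ b) d * (φ (a ℕ.+ b) * φ d)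
      ≈⟨ G-φ (a ℕ.+ b) d ⟩
    φ (a ℕ.+ b ℕ.+ d)
      ≡⟨ cong φ (ℕₚ.+-assoc a b d) ⟩
    φ (a ℕ.+ (b ℕ.+ d))
      ≈⟨ G-φ a (b ℕ.+ d) ⟨
    G a (b ℕ.+ d) * (φ a * φ (b ℕ.+ d))
      ≈⟨ *-congˡ (*-congˡ (G-φ b d)) ⟨
    G a (b ℕ.+ d) * (φ a * (G b d * (φ b * φ d)))
      ≈⟨ solve 5 (λ A B D x y → x :* (A :* (y :* (B :* D))) := A :* (x :* y) :* (B :* D)) ≈-refl (φ a) (φ b) (φ d) _ _ ⟩
    φ a * (G a (b ℕ.+ d) * G b d) * (φ b * φ d) ∎))

  M : ℕ → ℕ → Carrier
  M a b = [ suc (a ℕ.+ b) ] * G a b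

  -- That is, M a b = φ(a+b+1) / ((1-q) φ(a) φ(b)), which lets the modulus be handled like a
  -- q-binomial coefficient.
  M-φ : ∀ a b → (1# - q) * M a b * (φ a * φ b) ≈ φ (suc (a ℕ.+ b))
  M-φ a b = begin
    (1# - q) * ([ suc (a ℕ.+ b) ] * G a b) * (φ a * φ b)
      ≈⟨ solve 4 (λ x y z w → x :* (y :* z) :* w := (z :* w) :* (x :* y)) ≈-refl _ _ _ _ ⟩
    (G a b * (φ a * φ b)) * ((1# - q) * [ suc (a ℕ.+ b) ])
      ≈⟨ *-cong (G-φ a b) (1-q*[] (suc (a ℕ.+ b))) ⟩
    φ (suc (a ℕ.+ b)) ∎

  M-sym : ∀ a b → M a b ≈ M b a
  M-sym a b = *-cong (reflexive (cong (λ i → [ suc i ]) (ℕₚ.+-comm a b))) (G-sym a b)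

  -- Both sides are φ(s+v+f+1) / ((1-q) φ(s) φ(v) φ(f)). Read from left to right, a suitable
  -- q-binomial factor raises the first entry of the modulus from s to s + v.
  M-lift : ∀ s v f → G v (suc (s ℕ.+ f)) * M s f ≈ M (s ℕ.+ v) f * G s v
  M-lift s v f = 1-q-cancel (φ-cancel v (φφ-cancel s f (begin
    φ v * ((1# - q) * (G v (suc (s ℕ.+ f)) * M s f)) * (φ s * φ f)
      ≈⟨ solve 5 (λ V o x m w → V :* (o :* (x :* m)) :* w := x :* (V :* (o :* m :* w))) ≈-refl _ _ _ _ _ ⟩
    G v (suc (s ℕ.+ f)) * (φ v * ((1# - q) * M s f * (φ s * φ f)))
      ≈⟨ *-congˡ (*-congˡ (M-φ s f)) ⟩
    G v (suc (s ℕ.+ f)) * (φ v * φ (suc (s ℕ.+ f)))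
      ≈⟨ G-φ v (suc (s ℕ.+ f)) ⟩
    φ (v ℕ.+ suc (s ℕ.+ f))
      ≡⟨ cong φ (≡.trans (ℕₚ.+-suc v (s ℕ.+ f)) (cong suc (≡.trans (≡.sym (ℕₚ.+-assoc v s f)) (cong (ℕ._+ f) (ℕₚ.+-comm v s))))) ⟩
    φ (suc (s ℕ.+ v ℕ.+ f))
      ≈⟨ M-φ (s ℕ.+ v) f ⟨
    (1# - q) * M (s ℕ.+ v) f * (φ (s ℕ.+ v) * φ f)
      ≈⟨ *-congˡ (*-congʳ (G-φ s v)) ⟨
    (1# - q) * M (s ℕ.+ v) f * (G s v * (φ s * φ v) * φ f)
      ≈⟨ solve 6 (λ o m x S V F → o :* m :* (x :* (S :* V) :* F) := V :* (o :* (m :* x)) :* (S :* F)) ≈-refl _ _ _ _ _ _ ⟩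
    φ v * ((1# - q) * (M (s ℕ.+ v) f * G s v)) * (φ s * φ f) ∎)))

  -- `G (a ∸ k) b` would not do: for k > a the truncation gives `G 0 b`, which is 1, whereas a
  -- negative lower entry has to give 0.
  G∸ : ℕ → ℕ → ℕ → Carrier
  G∸ a       zero    b = G a b
  G∸ zero    (suc k) b = 0#
  G∸ (suc a) (suc k) b = G∸ a k b

  G∸-+ : ∀ k x b → G∸ (k ℕ.+ x) k b ≡ G x b
  G∸-+ zero    x b = refl
  G∸-+ (suc k) x b = G∸-+ k x b

  G∸-< : ∀ {a k} b → a < k → G∸ a k b ≡ 0#
  G∸-< {zero}  {suc k} b a<k       = refl
  G∸-< {suc a} {suc k} b (s≤s a<k) = G∸-< b a<k

  G∸-pascal : ∀ {a k} b → k ≤ a → G∸ a k (suc b) ≈ q ^ (a ∸ k) * G∸ a k b + G∸ a (suc k) (suc b)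
  G∸-pascal {zero}  {zero}  b k≤a       = solve 0 (:1 := :1 :* :1 :+ :0) ≈-refl
  G∸-pascal {suc a} {zero}  b k≤a       = +-comm _ _
  G∸-pascal {suc a} {suc k} b (s≤s k≤a) = G∸-pascal b k≤a

  β : ℕ → ℕ → ℕ → Carrier
  β a b k = G∸ a k (suc (b ℕ.+ k))

  -- The q-Vandermonde identity and its limit

  vandermondeTerm : ℕ → ℕ → ℕ → ℕ → Carrier
  vandermondeTerm x y d u = q ^ ((x ∸ u) ℕ.* (y ∸ u)) * (G∸ x u (u ℕ.+ d) * G∸ y u u)

  -- The right side of `q-vandermonde` depends on y and d only through y + d, so it suffices that
  -- the left side is unchanged when one unit moves from y to d. Pascal's rule on the first binomial
  -- for (y, d+1) and on the second for (y+1, d) leaves the same part `P`; the other parts are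
  -- `Q (suc u)` and `Q u`, so the difference telescopes.
  module Vandermonde (x y d : ℕ) where
    P Q : ℕ → Carrier
    P u       = q ^ ((x ∸ u) ℕ.* suc (y ∸ u)) * (G∸ x u (u ℕ.+ d) * G∸ y u u)
    Q zero    = 0#
    Q (suc u) = q ^ ((x ∸ u) ℕ.* (y ∸ u)) * (G∸ x (suc u) (suc u ℕ.+ d) * G∸ y u u)

    split₁ : ∀ u → u ≤ x → vandermondeTerm x y (suc d) u ≈ P u + Q (suc u)
    split₁ u u≤x = begin
      q ^ e * (G∸ x u (u ℕ.+ suc d) * D)
        ≡⟨ cong (λ i → q ^ e * (G∸ x u i * D)) (ℕₚ.+-suc u d) ⟩
      q ^ e * (G∸ x u (suc (u ℕ.+ d)) * D)
        ≈⟨ *-congˡ (*-congʳ (G∸-pascal (u ℕ.+ d) u≤x)) ⟩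
      q ^ e * ((q ^ (x ∸ u) * X + X′) * D)
        ≈⟨ solve 5 (λ p r X X′ D → r :* ((p :* X :+ X′) :* D) := p :* r :* (X :* D) :+ r :* (X′ :* D)) ≈-refl _ _ _ _ _ ⟩
      q ^ (x ∸ u) * q ^ e * (X * D) + q ^ e * (X′ * D)
        ≈⟨ +-congʳ (*-congʳ (≈-trans (≈-sym (q^-+ (x ∸ u) e)) (q^-≡ (≡.sym (ℕₚ.*-suc (x ∸ u) (y ∸ u)))))) ⟩
      P u + Q (suc u) ∎
      where
      e = (x ∸ u) ℕ.* (y ∸ u)
      D = G∸ y u u
      X = G∸ x u (u ℕ.+ d)
      X′ = G∸ x (suc u) (suc (u ℕ.+ d))

    split₂ : ∀ u → u ≤ x → vandermondeTerm x (suc y) d u ≈ P u + Q u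
    split₂ zero    u≤x = ≈-trans (*-congˡ (*-congˡ (reflexive (≡.sym (G-zeroʳ y))))) (≈-sym (+-identityʳ _))
    split₂ (suc u) u<x with u ℕ.≤? y
    ... | no u≰y = ≈-trans (zeroʳ′ (zeroʳ′ (vanish (suc u))))
      (≈-sym (≈-trans (+-cong (zeroʳ′ (zeroʳ′ (reflexive (G∸-< (suc u) (ℕₚ.m≤n⇒m≤1+n y<u))))) (zeroʳ′ (zeroʳ′ (vanish u)))) (+-identityˡ 0#)))
      where
      y<u = ℕₚ.≰⇒> u≰y
      vanish : ∀ b → G∸ y u b ≈ 0#
      vanish b = reflexive (G∸-< b y<u)
    ... | yes u≤y = begin
      q ^ (X ℕ.* Y) * (A * G∸ y u (suc u))
        ≈⟨ *-congˡ (*-congˡ (G∸-pascal u u≤y)) ⟩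
      q ^ (X ℕ.* Y) * (A * (q ^ Y * G∸ y u u + D))
        ≈⟨ solve 5 (λ e y A B D → e :* (A :* (y :* B :+ D)) := e :* (A :* D) :+ y :* e :* (A :* B)) ≈-refl _ _ _ _ _ ⟩
      q ^ (X ℕ.* Y) * (A * D) + q ^ Y * q ^ (X ℕ.* Y) * (A * G∸ y u u)
        ≈⟨ +-cong rearrange (*-congʳ (≈-trans (≈-sym (q^-+ Y (X ℕ.* Y))) (q^-≡ (cong (ℕ._* Y) (≡.sym (ℕₚ.+-∸-assoc 1 u<x)))))) ⟩
      P (suc u) + Q (suc u) ∎
      where
      X = x ∸ suc u
      Y = y ∸ u
      A = G∸ x (suc u) (suc u ℕ.+ d)
      D = G∸ y (suc u) (suc u)
      rearrange : q ^ (X ℕ.* Y) * (A * D) ≈ P (suc u)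
      -- For u < y the exponents agree. At u = y truncation gives exponent X in `P` instead of 0,
      -- which is harmless because the binomial factor `D` is 0 there.
      rearrange with u ℕ.<? y
      ... | yes u<y = *-congʳ (q^-≡ (cong (X ℕ.*_) (ℕₚ.+-∸-assoc 1 u<y)))
      ... | no  u≮y = ≈-trans (zeroʳ′ (zeroʳ′ D≈0)) (≈-sym (zeroʳ′ (zeroʳ′ D≈0)))
        where
        D≈0 : D ≈ 0#
        D≈0 = reflexive (G∸-< (suc u) (s≤s (ℕₚ.≮⇒≥ u≮y)))

    shift : Σ≤ x (vandermondeTerm x (suc y) d) ≈ Σ≤ x (vandermondeTerm x y (suc d))
    shift = begin
      Σ≤ x (vandermondeTerm x (suc y) d)               ≈⟨ +-identityʳ _ ⟨
      Σ≤ x (vandermondeTerm x (suc y) d) + 0#          ≈⟨ +-congˡ (zeroʳ′ (zeroˡ′ (reflexive (G∸-< {x} _ ℕₚ.≤-refl)))) ⟨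
      Σ≤ x (vandermondeTerm x (suc y) d) + Q (suc x)   ≈⟨ Σ-telescope x _ _ Q (λ u u≤x → ≈-trans (+-congʳ (split₂ u u≤x))
                                            (≈-trans (solve 3 (λ p r s → p :+ r :+ s := p :+ s :+ r) ≈-refl _ _ _) (+-congʳ (≈-sym (split₁ u u≤x))))) ⟩
      Σ≤ x (vandermondeTerm x y (suc d)) + 0#          ≈⟨ +-identityʳ _ ⟩
      Σ≤ x (vandermondeTerm x y (suc d))               ∎

  -- Choose x elements from a block of x + d and a block of y, with x - u in the first and u in the
  -- second. The exponent counts the pairs of a chosen element of the first block and an unchosen
  -- one of the second.
  q-vandermonde : ∀ x y d →
    Σ≤ x (λ u → q ^ ((x ∸ u) ℕ.* (y ∸ u)) * (G∸ x u (u ℕ.+ d) * G∸ y u u)) ≈ G x (y ℕ.+ d)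
  q-vandermonde x zero    d = begin
    Σ≤ x (vandermondeTerm x 0 d)   ≈⟨ Σ-truncate {0} {x} _ z≤n (λ { (suc k) _ → zeroʳ′ (zeroʳ _) }) ⟩
    q ^ (x ℕ.* 0) * (G x d * 1#)     ≈⟨ *-cong (q^-≡ (ℕₚ.*-zeroʳ x)) (*-identityʳ _) ⟩
    1# * G x d                       ≈⟨ *-identityˡ _ ⟩
    G x d                            ∎
  q-vandermonde x (suc y) d = begin
    Σ≤ x (vandermondeTerm x (suc y) d) ≈⟨ Vandermonde.shift x y d ⟩
    Σ≤ x (vandermondeTerm x y (suc d)) ≈⟨ q-vandermonde x y (suc d) ⟩
    G x (y ℕ.+ suc d)                    ≡⟨ cong (G x) (ℕₚ.+-suc y d) ⟩
    G x (suc y ℕ.+ d)                    ∎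

  -- ψ v e = (q^(e+1); q)_v
  ψ : ℕ → ℕ → Carrier
  ψ zero    e = 1#
  ψ (suc v) e = (1# - q ^ suc e) * ψ v (suc e)

  ψ-φ : ∀ v e → ψ v e * φ e ≈ φ (v ℕ.+ e)
  ψ-φ zero    e = *-identityˡ _
  ψ-φ (suc v) e = begin
    (1# - q ^ suc e) * ψ v (suc e) * φ e    ≈⟨ solve 3 (λ a b x → a :* b :* x := b :* (x :* a)) ≈-refl _ _ _ ⟩
    ψ v (suc e) * φ (suc e)                 ≈⟨ ψ-φ v (suc e) ⟩
    φ (v ℕ.+ suc e)                         ≡⟨ cong φ (ℕₚ.+-suc v e) ⟩
    φ (suc v ℕ.+ e)                         ∎

  -- The case y → ∞ of q-vandermonde.
  q-vandermonde-limit : ∀ x d → Σ≤ x (λ u → q ^ (u ℕ.* (u ℕ.+ d)) * (G u (x ∸ u) * ψ (x ∸ u) (u ℕ.+ d))) ≈ 1#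
  q-vandermonde-limit zero    d = solve 0 (:1 :* (:1 :* :1) := :1) ≈-refl
  q-vandermonde-limit (suc x) d = begin
    Σ≤ x f + f (suc x)   ≈⟨ +-congˡ last ⟩
    Σ≤ x f + h (suc x)   ≈⟨ Σ-telescope x f g h telescope ⟩
    Σ≤ x g + 0#          ≈⟨ +-identityʳ _ ⟩
    Σ≤ x g               ≈⟨ q-vandermonde-limit x (suc d) ⟩
    1#                   ∎
    where
    -- `f` and `g` are the summands for (x+1, d) and (x, d+1). Pascal's rule splits f u into A u + h
    -- u; splitting 1 as (1 - q^(u+d+1)) + q^(u+d+1) splits g u into A u + h (u+1), where the first
    -- part restores the missing factor of `ψ`.
    f g h A : ℕ → Carrier
    f u       = q ^ (u ℕ.* (u ℕ.+ d)) * (G u (suc x ∸ u) * ψ (suc x ∸ u) (u ℕ.+ d))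
    g u       = q ^ (u ℕ.* (u ℕ.+ suc d)) * (G u (x ∸ u) * ψ (x ∸ u) (u ℕ.+ suc d))
    h zero    = 0#
    h (suc u) = q ^ (suc u ℕ.* (suc u ℕ.+ d)) * (G u (x ∸ u) * ψ (x ∸ u) (suc u ℕ.+ d))
    A u       = q ^ (u ℕ.* (u ℕ.+ d)) * (q ^ u * G u (x ∸ u) * ψ (suc (x ∸ u)) (u ℕ.+ d))

    last : f (suc x) ≈ h (suc x)
    last = *-congˡ (*-cong (reflexive (≡.trans (cong (G (suc x)) (ℕₚ.n∸n≡0 x))
                     (≡.sym (≡.trans (cong (G x) (ℕₚ.n∸n≡0 x)) (G-zeroʳ x))))) ≈-refl)

    split-f : ∀ u → u ≤ x → f u ≈ A u + h u
    split-f zero    u≤x = solve 1 (λ p → :1 :* (:1 :* p) := :1 :* (:1 :* :1 :* p) :+ :0) ≈-refl _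
    split-f (suc u) u<x = begin
      E * (G (suc u) (x ∸ u) * ψ (x ∸ u) (suc u ℕ.+ d))
        ≡⟨ cong (λ i → E * (G (suc u) i * ψ i (suc u ℕ.+ d))) (ℕₚ.+-∸-assoc 1 u<x) ⟩
      E * ((G u (suc v) + q ^ suc u * G (suc u) v) * Ψ)
        ≈⟨ solve 5 (λ E a p b Ψ → E :* ((a :+ p :* b) :* Ψ) := E :* (p :* b :* Ψ) :+ E :* (a :* Ψ)) ≈-refl _ _ _ _ _ ⟩
      A (suc u) + E * (G u (suc v) * Ψ)
        ≡⟨ cong (λ i → A (suc u) + E * (G u i * ψ i (suc u ℕ.+ d))) (≡.sym (ℕₚ.+-∸-assoc 1 u<x)) ⟩
      A (suc u) + h (suc u) ∎
      where
      E = q ^ (suc u ℕ.* (suc u ℕ.+ d))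
      v = x ∸ suc u
      Ψ = ψ (suc v) (suc u ℕ.+ d)

    split-g : ∀ u → g u ≈ A u + h (suc u)
    split-g u = begin
      q ^ (u ℕ.* (u ℕ.+ suc d)) * (c′ * ψ (x ∸ u) (u ℕ.+ suc d))
        ≡⟨ cong (λ i → q ^ (u ℕ.* i) * (c′ * ψ (x ∸ u) i)) (ℕₚ.+-suc u d) ⟩
      q ^ (u ℕ.* suc (u ℕ.+ d)) * (c′ * Ψ)
        ≈⟨ solve 4 (λ E c Ψ p → E :* (c :* Ψ) := E :* (c :* ((:1 :- p) :* Ψ)) :+ (p :* E) :* (c :* Ψ)) ≈-refl _ _ _ (q ^ suc (u ℕ.+ d)) ⟩
      q ^ (u ℕ.* suc (u ℕ.+ d)) * (c′ * ψ (suc (x ∸ u)) (u ℕ.+ d)) + (q ^ suc (u ℕ.+ d) * q ^ (u ℕ.* suc (u ℕ.+ d))) * (c′ * Ψ)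
        ≈⟨ +-cong (*-congʳ (≈-trans (q^-≡ (ℕₚ.*-suc u (u ℕ.+ d))) (q^-+ u _))) (*-congʳ (≈-sym (q^-+ (suc (u ℕ.+ d)) _))) ⟩
      (q ^ u * q ^ (u ℕ.* (u ℕ.+ d))) * (c′ * ψ (suc (x ∸ u)) (u ℕ.+ d)) + h (suc u)
        ≈⟨ +-congʳ (solve 4 (λ p E c Ψ → (p :* E) :* (c :* Ψ) := E :* (p :* c :* Ψ)) ≈-refl _ _ _ _) ⟩
      A u + h (suc u) ∎
      where
      c′ = G u (x ∸ u)
      Ψ = ψ (x ∸ u) (suc (u ℕ.+ d))

    telescope : ∀ u → u ≤ x → f u + h (suc u) ≈ g u + h u
    telescope u u≤x = begin
      f u + h (suc u)           ≈⟨ +-congʳ (split-f u u≤x) ⟩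
      (A u + h u) + h (suc u)   ≈⟨ solve 3 (λ a b x → (a :+ b) :+ x := (a :+ x) :+ b) ≈-refl _ _ _ ⟩
      (A u + h (suc u)) + h u   ≈⟨ +-congʳ (split-g u) ⟨
      g u + h u                 ∎

  G-ψ : ∀ u v e → G u (v ℕ.+ e) * ψ v e ≈ ψ v (u ℕ.+ e) * G u e
  G-ψ u v e = φφ-cancel u e (begin
    G u (v ℕ.+ e) * ψ v e * (φ u * φ e)
      ≈⟨ solve 4 (λ a b x y → a :* b :* (x :* y) := a :* (x :* (b :* y))) ≈-refl _ _ _ _ ⟩
    G u (v ℕ.+ e) * (φ u * (ψ v e * φ e))
      ≈⟨ *-congˡ (*-congˡ (ψ-φ v e)) ⟩
    G u (v ℕ.+ e) * (φ u * φ (v ℕ.+ e))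
      ≈⟨ G-φ u (v ℕ.+ e) ⟩
    φ (u ℕ.+ (v ℕ.+ e))
      ≡⟨ cong φ (solveℕ 3 (λ u v e → u ⊕ (v ⊕ e) ⊜ v ⊕ (u ⊕ e)) refl u v e) ⟩
    φ (v ℕ.+ (u ℕ.+ e))
      ≈⟨ ψ-φ v (u ℕ.+ e) ⟨
    ψ v (u ℕ.+ e) * φ (u ℕ.+ e)
      ≈⟨ *-congˡ (G-φ u e) ⟨
    ψ v (u ℕ.+ e) * (G u e * (φ u * φ e))
      ≈⟨ *-assoc _ _ _ ⟨
    ψ v (u ℕ.+ e) * G u e * (φ u * φ e) ∎)

  -- Both sides are φ(s+v+f+1) / ((1-q) φ(s) φ(f)). Here a factor `ψ` raises the second entry of the
  -- modulus, as a q-binomial factor raises the first one in `M-lift`.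
  M-ψ : ∀ s v f → ψ v (suc (s ℕ.+ f)) * M s f ≈ M s (v ℕ.+ f) * ψ v f
  M-ψ s v f = 1-q-cancel (φφ-cancel s f (begin
    (1# - q) * (ψ v (suc (s ℕ.+ f)) * M s f) * (φ s * φ f)
      ≈⟨ solve 4 (λ o p m w → o :* (p :* m) :* w := p :* (o :* m :* w)) ≈-refl _ _ _ _ ⟩
    ψ v (suc (s ℕ.+ f)) * ((1# - q) * M s f * (φ s * φ f))
      ≈⟨ *-congˡ (M-φ s f) ⟩
    ψ v (suc (s ℕ.+ f)) * φ (suc (s ℕ.+ f))
      ≈⟨ ψ-φ v _ ⟩
    φ (v ℕ.+ suc (s ℕ.+ f))
      ≡⟨ cong φ (solveℕ 3 (λ s v f → v ⊕ (con′ 1 ⊕ (s ⊕ f)) ⊜ con′ 1 ⊕ (s ⊕ (v ⊕ f))) refl s v f) ⟩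
    φ (suc (s ℕ.+ (v ℕ.+ f)))
      ≈⟨ M-φ s (v ℕ.+ f) ⟨
    (1# - q) * M s (v ℕ.+ f) * (φ s * φ (v ℕ.+ f))
      ≈⟨ *-congˡ (*-congˡ (ψ-φ v f)) ⟨
    (1# - q) * M s (v ℕ.+ f) * (φ s * (ψ v f * φ f))
      ≈⟨ solve 5 (λ o m S p F → o :* m :* (S :* (p :* F)) := o :* (m :* p) :* (S :* F)) ≈-refl _ _ _ _ _ ⟩
    (1# - q) * (M s (v ℕ.+ f) * ψ v f) * (φ s * φ f) ∎))

  -- Expansion of products of q-binomial coefficients

  G∸-shift : ∀ k a s b → G∸ (k ℕ.+ a) (k ℕ.+ s) b ≡ G∸ a s b
  G∸-shift zero    a s b = refl
  G∸-shift (suc k) a s b = G∸-shift k a s b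

  G∸-∸ : ∀ {a k} b → k ≤ a → G∸ a k b ≡ G (a ∸ k) b
  G∸-∸ {a}     {zero}  b k≤a       = refl
  G∸-∸ {suc a} {suc k} b (s≤s k≤a) = G∸-∸ b k≤a

  β-> : ∀ {a k} b → a < k → β a b k ≈ 0#
  β-> b a<k = reflexive (G∸-< _ a<k)

  G∸-trinomial : ∀ x u b d → u ≤ x → G∸ x u b * G (x ∸ u ℕ.+ b) d ≈ G∸ x u (b ℕ.+ d) * G b d
  G∸-trinomial x u b d u≤x = begin
    G∸ x u b * G (x ∸ u ℕ.+ b) d       ≡⟨ cong (_* G (x ∸ u ℕ.+ b) d) (G∸-∸ b u≤x) ⟩
    G (x ∸ u) b * G (x ∸ u ℕ.+ b) d    ≈⟨ G-trinomial (x ∸ u) b d ⟩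
    G (x ∸ u) (b ℕ.+ d) * G b d        ≡⟨ cong (_* G b d) (G∸-∸ (b ℕ.+ d) u≤x) ⟨
    G∸ x u (b ℕ.+ d) * G b d           ∎

  -- Trinomial revision, valid for all u since both sides vanish for u > y. It replaces the
  -- dependence of the unshifted binomial on y by one on u.
  G∸-revise : ∀ y u d → G∸ y u u * G y d ≈ G∸ y u (u ℕ.+ d) * G u d
  G∸-revise y u d with u ℕ.≤? y
  ... | yes u≤y = ≈-trans (*-congˡ (reflexive (cong (λ i → G i d) (≡.sym (ℕₚ.m∸n+n≡m u≤y))))) (G∸-trinomial y u u d u≤y)
  ... | no  u≰y = ≈-trans (zeroˡ′ (reflexive (G∸-< u (ℕₚ.≰⇒> u≰y)))) (≈-sym (zeroˡ′ (reflexive (G∸-< _ (ℕₚ.≰⇒> u≰y)))))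

  -- Trinomial revision again, used with d = 2k + 1. In terms of s = k + u and f = k + g, the sum u
  -- + d + g is s + f + 1, so the first factor on the right no longer depends on k, and the second
  -- becomes `β f s k`.
  G∸-exchange : ∀ x u d g → u ≤ x → G∸ x u (u ℕ.+ d) * G g (x ℕ.+ d) ≈ G∸ x u (u ℕ.+ d ℕ.+ g) * G g (u ℕ.+ d)
  G∸-exchange x u d g u≤x = begin
    G∸ x u (u ℕ.+ d) * G g (x ℕ.+ d)
      ≈⟨ *-congˡ (≈-trans (G-sym g (x ℕ.+ d)) (reflexive (cong (λ i → G i g) x+d≡))) ⟩
    G∸ x u (u ℕ.+ d) * G (x ∸ u ℕ.+ (u ℕ.+ d)) g
      ≈⟨ G∸-trinomial x u (u ℕ.+ d) g u≤x ⟩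
    G∸ x u (u ℕ.+ d ℕ.+ g) * G (u ℕ.+ d) g
      ≈⟨ *-congˡ (G-sym (u ℕ.+ d) g) ⟩
    G∸ x u (u ℕ.+ d ℕ.+ g) * G g (u ℕ.+ d) ∎
    where
    x+d≡ : x ℕ.+ d ≡ x ∸ u ℕ.+ (u ℕ.+ d)
    x+d≡ = ≡.trans (cong (ℕ._+ d) (≡.sym (ℕₚ.m∸n+n≡m u≤x))) (ℕₚ.+-assoc (x ∸ u) u d)

  -- This trades the modulus at the summation index s for one that does not depend on s, so that it
  -- can be taken out of the sum. For s ≤ b it is `M-lift` with v = b - s; for s > b both sides
  -- vanish.
  β-M : ∀ b f s → β b f s * M s f ≈ M b f * G∸ b s s
  β-M b f s with s ℕ.≤? b
  ... | no  s≰b = ≈-trans (zeroˡ′ (β-> f (ℕₚ.≰⇒> s≰b))) (≈-sym (zeroʳ′ (reflexive (G∸-< s (ℕₚ.≰⇒> s≰b)))))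
  ... | yes s≤b = begin
    G∸ b s (suc (f ℕ.+ s)) * M s f              ≡⟨ cong (_* M s f) (≡.trans (G∸-∸ _ s≤b) (cong (λ i → G (b ∸ s) (suc i)) (ℕₚ.+-comm f s))) ⟩
    G (b ∸ s) (suc (s ℕ.+ f)) * M s f           ≈⟨ M-lift s (b ∸ s) f ⟩
    M (s ℕ.+ (b ∸ s)) f * G s (b ∸ s)           ≈⟨ *-cong (reflexive (cong (λ i → M i f) (ℕₚ.m+[n∸m]≡n s≤b))) (G-sym s (b ∸ s)) ⟩
    M b f * G (b ∸ s) s                         ≡⟨ cong (M b f *_) (G∸-∸ s s≤b) ⟨
    M b f * G∸ b s s                            ∎

  shift-index : ∀ k y → suc (k ℕ.+ y ℕ.+ k) ≡ y ℕ.+ suc (k ℕ.+ k)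
  shift-index = solveℕ 2 (λ k y → con′ 1 ⊕ (k ⊕ y ⊕ k) ⊜ y ⊕ (con′ 1 ⊕ (k ⊕ k))) refl

  -- s = k + u in the sums below, which turns them into q-vandermonde for x = a ∸ k, y = b ∸ k and d = 2k + 1.
  β-expand₃ : ∀ a b d f k → k ≤ a → β a b k * (β b d k * β f a k) ≈
    Σ≤ a (λ s → q ^ ((a ∸ s) ℕ.* (b ∸ s)) * (β a f s * β b d s) * (β s d k * β f s k))
  β-expand₃ a b d f k k≤a with k ℕ.≤? b | k ℕ.≤? f
  ... | no k≰b | _ = ≈-trans (zeroʳ′ (zeroˡ′ (β-> d (ℕₚ.≰⇒> k≰b)))) (≈-sym (Σ-zero a vanish))
    where
    vanish : ∀ s → s ≤ a → q ^ ((a ∸ s) ℕ.* (b ∸ s)) * (β a f s * β b d s) * (β s d k * β f s k) ≈ 0#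
    vanish s _ with k ℕ.≤? s
    ... | yes k≤s = zeroˡ′ (zeroʳ′ (zeroʳ′ (β-> d (ℕₚ.<-≤-trans (ℕₚ.≰⇒> k≰b) k≤s))))
    ... | no  k≰s = zeroʳ′ (zeroˡ′ (β-> d (ℕₚ.≰⇒> k≰s)))
  ... | yes _ | no k≰f = ≈-trans (zeroʳ′ (zeroʳ′ (β-> a (ℕₚ.≰⇒> k≰f))))
    (≈-sym (Σ-zero a λ s _ → zeroʳ′ (zeroʳ′ (β-> s (ℕₚ.≰⇒> k≰f)))))
  ... | yes k≤b | yes k≤f with ℕₚ.m≤n⇒∃[o]m+o≡n k≤a | ℕₚ.m≤n⇒∃[o]m+o≡n k≤b | ℕₚ.m≤n⇒∃[o]m+o≡n k≤f
  ... | x , refl | y , refl | g , refl = begin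
    β (k ℕ.+ x) (k ℕ.+ y) k * (β (k ℕ.+ y) d k * β (k ℕ.+ g) (k ℕ.+ x) k)
      ≡⟨ cong₂ _*_ (≡.trans (G∸-+ k x _) (cong (G x) (shift-index k y)))
           (cong₂ _*_ (G∸-+ k y _) (≡.trans (G∸-+ k g _) (cong (G g) (shift-index k x)))) ⟩
    G x (y ℕ.+ c′) * (G y D * G g (x ℕ.+ c′))
      ≈⟨ *-comm _ _ ⟩
    G y D * G g (x ℕ.+ c′) * G x (y ℕ.+ c′)
      ≈⟨ *-congˡ (q-vandermonde x y c′) ⟨
    G y D * G g (x ℕ.+ c′) * Σ≤ x (λ u → q ^ ((x ∸ u) ℕ.* (y ∸ u)) * (G∸ x u (u ℕ.+ c′) * G∸ y u u))
      ≈⟨ Σ-*ˡ x _ _ ⟨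
    Σ≤ x (λ u → G y D * G g (x ℕ.+ c′) * (q ^ ((x ∸ u) ℕ.* (y ∸ u)) * (G∸ x u (u ℕ.+ c′) * G∸ y u u)))
      ≈⟨ Σ-cong x summand ⟩
    Σ≤ x (λ u → F (k ℕ.+ u))
      ≈⟨ Σ-drop k x F (λ s s<k → zeroʳ′ (zeroˡ′ (β-> d s<k))) ⟨
    Σ≤ (k ℕ.+ x) F ∎
    where
    c′ = suc (k ℕ.+ k)
    D = suc (d ℕ.+ k)
    F : ℕ → Carrier
    F s = q ^ ((k ℕ.+ x ∸ s) ℕ.* (k ℕ.+ y ∸ s)) * (β (k ℕ.+ x) (k ℕ.+ g) s * β (k ℕ.+ y) d s) * (β s d k * β (k ℕ.+ g) s k)
    summand : ∀ u → u ≤ x →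
      G y D * G g (x ℕ.+ c′) * (q ^ ((x ∸ u) ℕ.* (y ∸ u)) * (G∸ x u (u ℕ.+ c′) * G∸ y u u)) ≈ F (k ℕ.+ u)
    summand u u≤x = begin
      G y D * G g (x ℕ.+ c′) * (E * (G∸ x u (u ℕ.+ c′) * G∸ y u u))
        ≈⟨ solve 5 (λ a b E x y → a :* b :* (E :* (x :* y)) := E :* ((x :* b) :* (y :* a))) ≈-refl _ _ _ _ _ ⟩
      E * ((G∸ x u (u ℕ.+ c′) * G g (x ℕ.+ c′)) * (G∸ y u u * G y D))
        ≈⟨ *-congˡ (*-cong (G∸-exchange x u c′ g u≤x) (G∸-revise y u D)) ⟩
      E * ((G∸ x u (u ℕ.+ c′ ℕ.+ g) * G g (u ℕ.+ c′)) * (G∸ y u (u ℕ.+ D) * G u D))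
        ≈⟨ solve 5 (λ E a b x y → E :* ((a :* b) :* (x :* y)) := E :* (a :* x) :* (y :* b)) ≈-refl _ _ _ _ _ ⟩
      E * (G∸ x u (u ℕ.+ c′ ℕ.+ g) * G∸ y u (u ℕ.+ D)) * (G u D * G g (u ℕ.+ c′))
        ≡⟨ cong₂ _*_ (cong₂ _*_ (cong₂ (λ i j → q ^ (i ℕ.* j)) (≡.sym (ℕₚ.[m+n]∸[m+o]≡n∸o k x u)) (≡.sym (ℕₚ.[m+n]∸[m+o]≡n∸o k y u)))
             (cong₂ _*_
               (≡.trans (cong (G∸ x u) (solveℕ 3 (λ k u g → u ⊕ (con′ 1 ⊕ (k ⊕ k)) ⊕ g ⊜ con′ 1 ⊕ (k ⊕ g ⊕ (k ⊕ u))) refl k u g)) (≡.sym (G∸-shift k x u _)))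
               (≡.trans (cong (G∸ y u) (solveℕ 3 (λ k u d → u ⊕ (con′ 1 ⊕ (d ⊕ k)) ⊜ con′ 1 ⊕ (d ⊕ (k ⊕ u))) refl k u d)) (≡.sym (G∸-shift k y u _)))))
             (cong₂ _*_ (≡.sym (G∸-+ k u _)) (≡.sym (≡.trans (G∸-+ k g _) (cong (G g) (shift-index k u))))) ⟩
      F (k ℕ.+ u) ∎
      where
      E = q ^ ((x ∸ u) ℕ.* (y ∸ u))

  -- The cycle through a and b reduces to the single kernel `β s s k`. Revising with y first turns
  -- `G y (x + c′)` into `G u (x + c′)`, so the exchange can then be made with g = u, which makes f
  -- equal to s.
  β-expand₂ : ∀ a b k → k ≤ a → β a b k * β b a k ≈
    Σ≤ a (λ s → q ^ ((a ∸ s) ℕ.* (b ∸ s)) * (β a s s * β b a s) * β s s k)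
  β-expand₂ a b k k≤a with k ℕ.≤? b
  ... | no k≰b = ≈-trans (zeroʳ′ (β-> a (ℕₚ.≰⇒> k≰b))) (≈-sym (Σ-zero a vanish))
    where
    vanish : ∀ s → s ≤ a → q ^ ((a ∸ s) ℕ.* (b ∸ s)) * (β a s s * β b a s) * β s s k ≈ 0#
    vanish s _ with k ℕ.≤? s
    ... | yes k≤s = zeroˡ′ (zeroʳ′ (zeroʳ′ (β-> a (ℕₚ.<-≤-trans (ℕₚ.≰⇒> k≰b) k≤s))))
    ... | no  k≰s = zeroʳ′ (β-> s (ℕₚ.≰⇒> k≰s))
  ... | yes k≤b with ℕₚ.m≤n⇒∃[o]m+o≡n k≤a | ℕₚ.m≤n⇒∃[o]m+o≡n k≤b
  ... | x , refl | y , refl = begin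
    β (k ℕ.+ x) (k ℕ.+ y) k * β (k ℕ.+ y) (k ℕ.+ x) k
      ≡⟨ cong₂ _*_ (≡.trans (G∸-+ k x _) (cong (G x) (shift-index k y))) (≡.trans (G∸-+ k y _) (cong (G y) (shift-index k x))) ⟩
    G x (y ℕ.+ c′) * G y (x ℕ.+ c′)
      ≈⟨ *-comm _ _ ⟩
    G y (x ℕ.+ c′) * G x (y ℕ.+ c′)
      ≈⟨ *-congˡ (q-vandermonde x y c′) ⟨
    G y (x ℕ.+ c′) * Σ≤ x (λ u → q ^ ((x ∸ u) ℕ.* (y ∸ u)) * (G∸ x u (u ℕ.+ c′) * G∸ y u u))
      ≈⟨ Σ-*ˡ x _ _ ⟨
    Σ≤ x (λ u → G y (x ℕ.+ c′) * (q ^ ((x ∸ u) ℕ.* (y ∸ u)) * (G∸ x u (u ℕ.+ c′) * G∸ y u u)))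
      ≈⟨ Σ-cong x summand ⟩
    Σ≤ x (λ u → F (k ℕ.+ u))
      ≈⟨ Σ-drop k x F (λ s s<k → zeroʳ′ (β-> s s<k)) ⟨
    Σ≤ (k ℕ.+ x) F ∎
    where
    c′ = suc (k ℕ.+ k)
    F : ℕ → Carrier
    F s = q ^ ((k ℕ.+ x ∸ s) ℕ.* (k ℕ.+ y ∸ s)) * (β (k ℕ.+ x) s s * β (k ℕ.+ y) (k ℕ.+ x) s) * β s s k
    summand : ∀ u → u ≤ x →
      G y (x ℕ.+ c′) * (q ^ ((x ∸ u) ℕ.* (y ∸ u)) * (G∸ x u (u ℕ.+ c′) * G∸ y u u)) ≈ F (k ℕ.+ u)
    summand u u≤x = begin
      G y (x ℕ.+ c′) * (E * (G∸ x u (u ℕ.+ c′) * G∸ y u u))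
        ≈⟨ solve 4 (λ a E x y → a :* (E :* (x :* y)) := E :* (x :* (y :* a))) ≈-refl _ _ _ _ ⟩
      E * (G∸ x u (u ℕ.+ c′) * (G∸ y u u * G y (x ℕ.+ c′)))
        ≈⟨ *-congˡ (*-congˡ (G∸-revise y u (x ℕ.+ c′))) ⟩
      E * (G∸ x u (u ℕ.+ c′) * (G∸ y u (u ℕ.+ (x ℕ.+ c′)) * G u (x ℕ.+ c′)))
        ≈⟨ solve 4 (λ E a b x → E :* (a :* (b :* x)) := E :* b :* (a :* x)) ≈-refl _ _ _ _ ⟩
      E * G∸ y u (u ℕ.+ (x ℕ.+ c′)) * (G∸ x u (u ℕ.+ c′) * G u (x ℕ.+ c′))
        ≈⟨ *-congˡ (G∸-exchange x u c′ u u≤x) ⟩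
      E * G∸ y u (u ℕ.+ (x ℕ.+ c′)) * (G∸ x u (u ℕ.+ c′ ℕ.+ u) * G u (u ℕ.+ c′))
        ≈⟨ solve 4 (λ E b a x → E :* b :* (a :* x) := E :* (a :* b) :* x) ≈-refl _ _ _ _ ⟩
      E * (G∸ x u (u ℕ.+ c′ ℕ.+ u) * G∸ y u (u ℕ.+ (x ℕ.+ c′))) * G u (u ℕ.+ c′)
        ≡⟨ cong₂ _*_ (cong₂ _*_ (cong₂ (λ i j → q ^ (i ℕ.* j)) (≡.sym (ℕₚ.[m+n]∸[m+o]≡n∸o k x u)) (≡.sym (ℕₚ.[m+n]∸[m+o]≡n∸o k y u)))
             (cong₂ _*_
               (≡.trans (cong (G∸ x u) (solveℕ 2 (λ k u → u ⊕ (con′ 1 ⊕ (k ⊕ k)) ⊕ u ⊜ con′ 1 ⊕ (k ⊕ u ⊕ (k ⊕ u))) refl k u)) (≡.sym (G∸-shift k x u _)))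
               (≡.trans (cong (G∸ y u) (solveℕ 3 (λ k u x → u ⊕ (x ⊕ (con′ 1 ⊕ (k ⊕ k))) ⊜ con′ 1 ⊕ (k ⊕ x ⊕ (k ⊕ u))) refl k u x)) (≡.sym (G∸-shift k y u _)))))
             (≡.sym (≡.trans (G∸-+ k u _) (cong (G u) (shift-index k u)))) ⟩
      F (k ℕ.+ u) ∎
      where
      E = q ^ ((x ∸ u) ℕ.* (y ∸ u))

  -- Completing the square: with s = k + u, the exponents k^2 + k and u(u+2k+1) add up to s^2 + s.
  -- The weight q^(k^2+k) thus moves to the outer index and leaves the inner sum over k.
  β-expand₁ : ∀ a k → k ≤ a → q ^ (k ℕ.* k ℕ.+ k) * β a a k ≈
    Σ≤ a (λ s → q ^ (s ℕ.* s ℕ.+ s) * (β a a s * ψ (a ∸ s) (suc (s ℕ.+ s))) * β s s k)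
  β-expand₁ a k k≤a with ℕₚ.m≤n⇒∃[o]m+o≡n k≤a
  ... | x , refl = begin
    K * β (k ℕ.+ x) (k ℕ.+ x) k
      ≡⟨ cong (K *_) (≡.trans (G∸-+ k x _) (cong (G x) (shift-index k x))) ⟩
    K * G x (x ℕ.+ c′)
      ≈⟨ *-identityʳ _ ⟨
    K * G x (x ℕ.+ c′) * 1#
      ≈⟨ *-congˡ (q-vandermonde-limit x c′) ⟨
    K * G x (x ℕ.+ c′) * Σ≤ x (λ u → q ^ (u ℕ.* (u ℕ.+ c′)) * (G u (x ∸ u) * ψ (x ∸ u) (u ℕ.+ c′)))
      ≈⟨ Σ-*ˡ x _ _ ⟨
    Σ≤ x (λ u → K * G x (x ℕ.+ c′) * (q ^ (u ℕ.* (u ℕ.+ c′)) * (G u (x ∸ u) * ψ (x ∸ u) (u ℕ.+ c′))))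
      ≈⟨ Σ-cong x summand ⟩
    Σ≤ x (λ u → F (k ℕ.+ u))
      ≈⟨ Σ-drop k x F (λ s s<k → zeroʳ′ (β-> s s<k)) ⟨
    Σ≤ (k ℕ.+ x) F ∎
    where
    c′ = suc (k ℕ.+ k)
    K = q ^ (k ℕ.* k ℕ.+ k)
    F : ℕ → Carrier
    F s = q ^ (s ℕ.* s ℕ.+ s) * (β (k ℕ.+ x) (k ℕ.+ x) s * ψ (k ℕ.+ x ∸ s) (suc (s ℕ.+ s))) * β s s k
    summand : ∀ u → u ≤ x →
      K * G x (x ℕ.+ c′) * (q ^ (u ℕ.* (u ℕ.+ c′)) * (G u (x ∸ u) * ψ (x ∸ u) (u ℕ.+ c′))) ≈ F (k ℕ.+ u)
    summand u u≤x = begin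
      K * G x (x ℕ.+ c′) * (q ^ (u ℕ.* (u ℕ.+ c′)) * (G u v * Ψ))
        ≈⟨ solve 5 (λ K a E b p → K :* a :* (E :* (b :* p)) := (K :* E) :* ((b :* a) :* p)) ≈-refl _ _ _ _ _ ⟩
      (K * q ^ (u ℕ.* (u ℕ.+ c′))) * ((G u v * G x (x ℕ.+ c′)) * Ψ)
        ≈⟨ *-congˡ (*-congʳ (≈-trans (*-congʳ (≈-trans (G-sym u v) (reflexive (≡.sym (G∸-∸ u u≤x))))) (G∸-revise x u (x ℕ.+ c′)))) ⟩
      (K * q ^ (u ℕ.* (u ℕ.+ c′))) * ((G∸ x u (u ℕ.+ (x ℕ.+ c′)) * G u (x ℕ.+ c′)) * Ψ)
        ≈⟨ *-cong (≈-trans (≈-sym (q^-+ (k ℕ.* k ℕ.+ k) _)) (q^-≡ exponent)) (*-assoc _ _ _) ⟩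
      E * (G∸ x u (u ℕ.+ (x ℕ.+ c′)) * (G u (x ℕ.+ c′) * Ψ))
        ≡⟨ cong (λ i → E * (G∸ x u (u ℕ.+ (x ℕ.+ c′)) * (G u i * Ψ))) (≡.trans (cong (ℕ._+ c′) (≡.sym (ℕₚ.m∸n+n≡m u≤x))) (ℕₚ.+-assoc v u c′)) ⟩
      E * (G∸ x u (u ℕ.+ (x ℕ.+ c′)) * (G u (v ℕ.+ (u ℕ.+ c′)) * Ψ))
        ≈⟨ *-congˡ (*-congˡ (G-ψ u v (u ℕ.+ c′))) ⟩
      E * (G∸ x u (u ℕ.+ (x ℕ.+ c′)) * (ψ v (u ℕ.+ (u ℕ.+ c′)) * G u (u ℕ.+ c′)))
        ≈⟨ solve 4 (λ E a b x → E :* (a :* (b :* x)) := E :* (a :* b) :* x) ≈-refl _ _ _ _ ⟩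
      E * (G∸ x u (u ℕ.+ (x ℕ.+ c′)) * ψ v (u ℕ.+ (u ℕ.+ c′))) * G u (u ℕ.+ c′)
        ≡⟨ cong₂ _*_ (cong (E *_) (cong₂ _*_
             (≡.trans (cong (G∸ x u) (solveℕ 3 (λ k u x → u ⊕ (x ⊕ (con′ 1 ⊕ (k ⊕ k))) ⊜ con′ 1 ⊕ (k ⊕ x ⊕ (k ⊕ u))) refl k u x)) (≡.sym (G∸-shift k x u _)))
             (cong₂ ψ (≡.sym (ℕₚ.[m+n]∸[m+o]≡n∸o k x u)) (solveℕ 2 (λ k u → u ⊕ (u ⊕ (con′ 1 ⊕ (k ⊕ k))) ⊜ con′ 1 ⊕ (k ⊕ u ⊕ (k ⊕ u))) refl k u))))
             (≡.sym (≡.trans (G∸-+ k u _) (cong (G u) (shift-index k u)))) ⟩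
      F (k ℕ.+ u) ∎
      where
      v = x ∸ u
      Ψ = ψ v (u ℕ.+ c′)
      E = q ^ ((k ℕ.+ u) ℕ.* (k ℕ.+ u) ℕ.+ (k ℕ.+ u))
      exponent : k ℕ.* k ℕ.+ k ℕ.+ u ℕ.* (u ℕ.+ c′) ≡ (k ℕ.+ u) ℕ.* (k ℕ.+ u) ℕ.+ (k ℕ.+ u)
      exponent = solveℕ 2 (λ k u → k ⊗ k ⊕ k ⊕ u ⊗ (u ⊕ (con′ 1 ⊕ (k ⊕ k))) ⊜ (k ⊕ u) ⊗ (k ⊕ u) ⊕ (k ⊕ u)) refl k u

  -- Weighted sums divisible by M

  -- Interchanging the sums leaves, for each s, the inner sum of `W` against the kernel `J s`, cut
  -- off at s where `J` vanishes. Its known value F s is inserted, so evaluations at all s ≤ a yield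
  -- one for the kernel `K` at a.
  transfer : ∀ e a (W K X : ℕ → Carrier) (J : ℕ → ℕ → Carrier) (F : ℕ → Carrier) →
    (∀ k → k ≤ a → K k ≈ Σ≤ a (λ s → X s * J s k)) →
    (∀ s k → s < k → J s k ≈ 0#) →
    (∀ s → Σ≤ s (λ k → q ^ (e ℕ.* (s ∸ k)) * (W k * J s k)) ≈ F s) →
    Σ≤ a (λ k → q ^ (e ℕ.* (a ∸ k)) * (W k * K k)) ≈ Σ≤ a (λ s → q ^ (e ℕ.* (a ∸ s)) * (X s * F s))
  transfer e a W K X J F K≈ J≈0 F≈ = begin
    Σ≤ a (λ k → p k * (W k * K k))
      ≈⟨ Σ-cong a (λ k k≤a → begin
           p k * (W k * K k)                            ≈⟨ *-congˡ (*-congˡ (K≈ k k≤a)) ⟩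
           p k * (W k * Σ≤ a (λ s → X s * J s k))       ≈⟨ *-assoc _ _ _ ⟨
           p k * W k * Σ≤ a (λ s → X s * J s k)         ≈⟨ Σ-*ˡ a _ _ ⟨
           Σ≤ a (λ s → p k * W k * (X s * J s k))       ∎) ⟩
    Σ≤ a (λ k → Σ≤ a (λ s → p k * W k * (X s * J s k)))
      ≈⟨ Σ-swap a a _ ⟩
    Σ≤ a (λ s → Σ≤ a (λ k → p k * W k * (X s * J s k)))
      ≈⟨ Σ-cong a (λ s s≤a → begin
           Σ≤ a (λ k → p k * W k * (X s * J s k))
             ≈⟨ Σ-truncate _ s≤a (λ k s<k → zeroʳ′ (zeroʳ′ (J≈0 s k s<k))) ⟩
           Σ≤ s (λ k → p k * W k * (X s * J s k))
             ≈⟨ Σ-cong s (λ k k≤s → begin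
                  p k * W k * (X s * J s k)
                    ≈⟨ *-congʳ (*-congʳ (≈-trans (q^-≡ (exponent s≤a k≤s)) (q^-+ (e ℕ.* (a ∸ s)) (e ℕ.* (s ∸ k))))) ⟩
                  (p s * q ^ (e ℕ.* (s ∸ k))) * W k * (X s * J s k)
                    ≈⟨ solve 5 (λ a b W X J → (a :* b) :* W :* (X :* J) := (a :* X) :* (b :* (W :* J))) ≈-refl _ _ _ _ _ ⟩
                  (p s * X s) * (q ^ (e ℕ.* (s ∸ k)) * (W k * J s k)) ∎) ⟩
           Σ≤ s (λ k → (p s * X s) * (q ^ (e ℕ.* (s ∸ k)) * (W k * J s k)))
             ≈⟨ Σ-*ˡ s _ _ ⟩
           (p s * X s) * Σ≤ s (λ k → q ^ (e ℕ.* (s ∸ k)) * (W k * J s k))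
             ≈⟨ *-congˡ (F≈ s) ⟩
           (p s * X s) * F s
             ≈⟨ *-assoc _ _ _ ⟩
           p s * (X s * F s) ∎) ⟩
    Σ≤ a (λ s → p s * (X s * F s)) ∎
    where
    p : ℕ → Carrier
    p k = q ^ (e ℕ.* (a ∸ k))
    exponent : ∀ {s k} → s ≤ a → k ≤ s → e ℕ.* (a ∸ k) ≡ e ℕ.* (a ∸ s) ℕ.+ e ℕ.* (s ∸ k)
    exponent {s} {k} s≤a k≤s = ≡.trans (cong (e ℕ.*_) (≡.sym
      (≡.trans (≡.sym (ℕₚ.+-∸-assoc (a ∸ s) k≤s)) (cong (_∸ k) (ℕₚ.m∸n+n≡m s≤a)))))
      (ℕₚ.*-distribˡ-+ e (a ∸ s) (s ∸ k))

  -- e carries the weights w k * q ^ (- e k), with the negative powers cleared by the factor q ^ (e n).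
  record Good (e : ℕ) (w : ℕ → Carrier) : Set (c ⊔ ℓ) where
    constructor good
    field
      {quotient} : ℕ → Carrier
      Σ≈M* : ∀ n → Σ≤ n (λ k → q ^ (e ℕ.* (n ∸ k)) * (w k * β n n k)) ≈ M n n * quotient n

  -- The same for cyclic products whose factors at a are β a d and β f a; the other factors are part of w.
  record GoodPair (e d f : ℕ) (w : ℕ → Carrier) : Set (c ⊔ ℓ) where
    constructor goodPair
    field
      {quotient} : ℕ → Carrier
      Σ≈M* : ∀ a → Σ≤ a (λ k → q ^ (e ℕ.* (a ∸ k)) * (w k * (β a d k * β f a k))) ≈ M a f * quotient a

  -- The modulus M s s is raised twice: `β a s s` makes it M a s, and by symmetry `β b a s` turns M
  -- s a into M b a. The coefficient in `β-expand₂` supplies exactly these two factors.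
  Good⇒GoodPair : ∀ {e w} b → Good e w → GoodPair e b b w
  Good⇒GoodPair {e} {w} b (good {H} Σw) = goodPair λ a → begin
    Σ≤ a (λ k → q ^ (e ℕ.* (a ∸ k)) * (w k * (β a b k * β b a k)))
      ≈⟨ transfer e a w _ _ (λ s k → β s s k) _ (β-expand₂ a b) (λ s k → β-> s) Σw ⟩
    Σ≤ a (λ s → q ^ (e ℕ.* (a ∸ s)) * (q ^ ((a ∸ s) ℕ.* (b ∸ s)) * (β a s s * β b a s) * (M s s * H s)))
      ≈⟨ Σ-cong a (λ s _ → begin
           q ^ (e ℕ.* (a ∸ s)) * (q ^ ((a ∸ s) ℕ.* (b ∸ s)) * (β a s s * β b a s) * (M s s * H s))
             ≈⟨ solve 6 (λ p r x y m h → p :* (r :* (x :* y) :* (m :* h)) := p :* (r :* (y :* (x :* m) :* h))) ≈-refl _ _ _ _ _ _ ⟩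
           q ^ (e ℕ.* (a ∸ s)) * (q ^ ((a ∸ s) ℕ.* (b ∸ s)) * (β b a s * (β a s s * M s s) * H s))
             ≈⟨ *-congˡ (*-congˡ (*-congʳ (M-step a s))) ⟩
           q ^ (e ℕ.* (a ∸ s)) * (q ^ ((a ∸ s) ℕ.* (b ∸ s)) * (M a b * (G∸ a s s * G∸ b s s) * H s))
             ≈⟨ solve 5 (λ p r m x h → p :* (r :* (m :* x :* h)) := m :* (p :* (r :* (x :* h)))) ≈-refl _ _ _ _ _ ⟩
           M a b * (q ^ (e ℕ.* (a ∸ s)) * (q ^ ((a ∸ s) ℕ.* (b ∸ s)) * (G∸ a s s * G∸ b s s * H s))) ∎) ⟩
    Σ≤ a (λ s → M a b * (q ^ (e ℕ.* (a ∸ s)) * (q ^ ((a ∸ s) ℕ.* (b ∸ s)) * (G∸ a s s * G∸ b s s * H s))))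
      ≈⟨ Σ-*ˡ a _ _ ⟩
    M a b * Σ≤ a (λ s → q ^ (e ℕ.* (a ∸ s)) * (q ^ ((a ∸ s) ℕ.* (b ∸ s)) * (G∸ a s s * G∸ b s s * H s))) ∎
    where
    M-step : ∀ a s → β b a s * (β a s s * M s s) ≈ M a b * (G∸ a s s * G∸ b s s)
    M-step a s = begin
      β b a s * (β a s s * M s s)       ≈⟨ *-congˡ (β-M a s s) ⟩
      β b a s * (M a s * G∸ a s s)      ≈⟨ *-congˡ (*-congʳ (M-sym a s)) ⟩
      β b a s * (M s a * G∸ a s s)      ≈⟨ *-assoc _ _ _ ⟨
      β b a s * M s a * G∸ a s s        ≈⟨ *-congʳ (β-M b a s) ⟩
      M b a * G∸ b s s * G∸ a s s       ≈⟨ *-congʳ (*-congʳ (M-sym b a)) ⟩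
      M a b * G∸ b s s * G∸ a s s       ≈⟨ solve 3 (λ m x y → m :* x :* y := m :* (y :* x)) ≈-refl _ _ _ ⟩
      M a b * (G∸ a s s * G∸ b s s)     ∎

  -- A new vertex b is inserted between a and d, so `β b d k` joins the weight. The neighbour f on
  -- the other side is untouched, and `β a f s` alone raises M s f to M a f; the modulus therefore
  -- never involves the vertices in between.
  GoodPair-step : ∀ {e d f w} b → GoodPair e d f w → GoodPair e b f (λ k → β b d k * w k)
  GoodPair-step {e} {d} {f} {w} b (goodPair {H} Σw) = goodPair λ a → begin
    Σ≤ a (λ k → q ^ (e ℕ.* (a ∸ k)) * (β b d k * w k * (β a b k * β f a k)))
      ≈⟨ Σ-cong a (λ k _ → *-congˡ (solve 4 (λ y w x z → y :* w :* (x :* z) := w :* (x :* (y :* z))) ≈-refl _ _ _ _)) ⟩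
    Σ≤ a (λ k → q ^ (e ℕ.* (a ∸ k)) * (w k * (β a b k * (β b d k * β f a k))))
      ≈⟨ transfer e a w _ _ (λ s k → β s d k * β f s k) _ (β-expand₃ a b d f) (λ s k s<k → zeroˡ′ (β-> d s<k)) Σw ⟩
    Σ≤ a (λ s → q ^ (e ℕ.* (a ∸ s)) * (q ^ ((a ∸ s) ℕ.* (b ∸ s)) * (β a f s * β b d s) * (M s f * H s)))
      ≈⟨ Σ-cong a (λ s _ → begin
           q ^ (e ℕ.* (a ∸ s)) * (q ^ ((a ∸ s) ℕ.* (b ∸ s)) * (β a f s * β b d s) * (M s f * H s))
             ≈⟨ solve 6 (λ p r x y m h → p :* (r :* (x :* y) :* (m :* h)) := p :* (r :* ((x :* m) :* (y :* h)))) ≈-refl _ _ _ _ _ _ ⟩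
           q ^ (e ℕ.* (a ∸ s)) * (q ^ ((a ∸ s) ℕ.* (b ∸ s)) * ((β a f s * M s f) * (β b d s * H s)))
             ≈⟨ *-congˡ (*-congˡ (*-congʳ (β-M a f s))) ⟩
           q ^ (e ℕ.* (a ∸ s)) * (q ^ ((a ∸ s) ℕ.* (b ∸ s)) * ((M a f * G∸ a s s) * (β b d s * H s)))
             ≈⟨ solve 5 (λ p r m x h → p :* (r :* ((m :* x) :* h)) := m :* (p :* (r :* (x :* h)))) ≈-refl _ _ _ _ _ ⟩
           M a f * (q ^ (e ℕ.* (a ∸ s)) * (q ^ ((a ∸ s) ℕ.* (b ∸ s)) * (G∸ a s s * (β b d s * H s)))) ∎) ⟩
    Σ≤ a (λ s → M a f * (q ^ (e ℕ.* (a ∸ s)) * (q ^ ((a ∸ s) ℕ.* (b ∸ s)) * (G∸ a s s * (β b d s * H s)))))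
      ≈⟨ Σ-*ˡ a _ _ ⟩
    M a f * Σ≤ a (λ s → q ^ (e ℕ.* (a ∸ s)) * (q ^ ((a ∸ s) ℕ.* (b ∸ s)) * (G∸ a s s * (β b d s * H s)))) ∎

  -- The modulus M s s is raised in two stages: the factor `ψ` makes it M s a, then `β a a s` makes
  -- it M a a.
  Good-q^[k²+k] : ∀ {e w} → Good e w → Good e (λ k → q ^ (k ℕ.* k ℕ.+ k) * w k)
  Good-q^[k²+k] {e} {w} (good {H} Σw) = good λ a → begin
    Σ≤ a (λ k → q ^ (e ℕ.* (a ∸ k)) * (q ^ (k ℕ.* k ℕ.+ k) * w k * β a a k))
      ≈⟨ Σ-cong a (λ k _ → *-congˡ (solve 3 (λ x w y → x :* w :* y := w :* (x :* y)) ≈-refl _ _ _)) ⟩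
    Σ≤ a (λ k → q ^ (e ℕ.* (a ∸ k)) * (w k * (q ^ (k ℕ.* k ℕ.+ k) * β a a k)))
      ≈⟨ transfer e a w _ _ (λ s k → β s s k) _ (β-expand₁ a) (λ s k → β-> s) Σw ⟩
    Σ≤ a (λ s → q ^ (e ℕ.* (a ∸ s)) * (q ^ (s ℕ.* s ℕ.+ s) * (β a a s * ψ (a ∸ s) (suc (s ℕ.+ s))) * (M s s * H s)))
      ≈⟨ Σ-cong a (λ s s≤a → begin
           q ^ (e ℕ.* (a ∸ s)) * (q ^ (s ℕ.* s ℕ.+ s) * (β a a s * ψ (a ∸ s) (suc (s ℕ.+ s))) * (M s s * H s))
             ≈⟨ solve 6 (λ p r x y m h → p :* (r :* (x :* y) :* (m :* h)) := p :* (r :* (x :* (y :* m) :* h))) ≈-refl _ _ _ _ _ _ ⟩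
           q ^ (e ℕ.* (a ∸ s)) * (q ^ (s ℕ.* s ℕ.+ s) * (β a a s * (ψ (a ∸ s) (suc (s ℕ.+ s)) * M s s) * H s))
             ≈⟨ *-congˡ (*-congˡ (*-congʳ (M-step a s s≤a))) ⟩
           q ^ (e ℕ.* (a ∸ s)) * (q ^ (s ℕ.* s ℕ.+ s) * (M a a * (G∸ a s s * ψ (a ∸ s) s) * H s))
             ≈⟨ solve 5 (λ p r m x h → p :* (r :* (m :* x :* h)) := m :* (p :* (r :* (x :* h)))) ≈-refl _ _ _ _ _ ⟩
           M a a * (q ^ (e ℕ.* (a ∸ s)) * (q ^ (s ℕ.* s ℕ.+ s) * (G∸ a s s * ψ (a ∸ s) s * H s))) ∎) ⟩
    Σ≤ a (λ s → M a a * (q ^ (e ℕ.* (a ∸ s)) * (q ^ (s ℕ.* s ℕ.+ s) * (G∸ a s s * ψ (a ∸ s) s * H s))))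
      ≈⟨ Σ-*ˡ a _ _ ⟩
    M a a * Σ≤ a (λ s → q ^ (e ℕ.* (a ∸ s)) * (q ^ (s ℕ.* s ℕ.+ s) * (G∸ a s s * ψ (a ∸ s) s * H s))) ∎
    where
    M-step : ∀ a s → s ≤ a → β a a s * (ψ (a ∸ s) (suc (s ℕ.+ s)) * M s s) ≈ M a a * (G∸ a s s * ψ (a ∸ s) s)
    M-step a s s≤a = begin
      β a a s * (ψ (a ∸ s) (suc (s ℕ.+ s)) * M s s)  ≈⟨ *-congˡ (M-ψ s (a ∸ s) s) ⟩
      β a a s * (M s (a ∸ s ℕ.+ s) * ψ (a ∸ s) s)    ≡⟨ cong (λ i → β a a s * (M s i * ψ (a ∸ s) s)) (ℕₚ.m∸n+n≡m s≤a) ⟩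
      β a a s * (M s a * ψ (a ∸ s) s)                ≈⟨ *-assoc _ _ _ ⟨
      β a a s * M s a * ψ (a ∸ s) s                  ≈⟨ *-congʳ (β-M a a s) ⟩
      M a a * G∸ a s s * ψ (a ∸ s) s                 ≈⟨ *-assoc _ _ _ ⟩
      M a a * (G∸ a s s * ψ (a ∸ s) s)               ∎

  -- Linear combinations of good weights, and products with q-integers

  Good-cong : ∀ {e w w′} → (∀ k → w k ≈ w′ k) → Good e w → Good e w′
  Good-cong w≈w′ (good Σw) = good λ n → ≈-trans (Σ-cong n λ k _ → *-congˡ (*-congʳ (≈-sym (w≈w′ k)))) (Σw n)

  Good-+ : ∀ {e w w′} → Good e w → Good e w′ → Good e (λ k → w k + w′ k)
  Good-+ {e} {w} {w′} (good {H} Σw) (good {H′} Σw′) = good λ n → begin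
    Σ≤ n (λ k → q ^ (e ℕ.* (n ∸ k)) * ((w k + w′ k) * β n n k))
      ≈⟨ Σ-cong n (λ k _ → solve 4 (λ p x y b → p :* ((x :+ y) :* b) := p :* (x :* b) :+ p :* (y :* b)) ≈-refl _ _ _ _) ⟩
    Σ≤ n (λ k → q ^ (e ℕ.* (n ∸ k)) * (w k * β n n k) + q ^ (e ℕ.* (n ∸ k)) * (w′ k * β n n k))
      ≈⟨ Σ-+ n _ _ ⟩
    Σ≤ n (λ k → q ^ (e ℕ.* (n ∸ k)) * (w k * β n n k)) + Σ≤ n (λ k → q ^ (e ℕ.* (n ∸ k)) * (w′ k * β n n k))
      ≈⟨ +-cong (Σw n) (Σw′ n) ⟩
    M n n * H n + M n n * H′ n
      ≈⟨ distribˡ _ _ _ ⟨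
    M n n * (H n + H′ n) ∎

  Good-* : ∀ {e w} x → Good e w → Good e (λ k → x * w k)
  Good-* {e} {w} x (good {H} Σw) = good λ n → begin
    Σ≤ n (λ k → q ^ (e ℕ.* (n ∸ k)) * (x * w k * β n n k))
      ≈⟨ Σ-cong n (λ k _ → solve 4 (λ p x w b → p :* (x :* w :* b) := x :* (p :* (w :* b))) ≈-refl _ _ _ _) ⟩
    Σ≤ n (λ k → x * (q ^ (e ℕ.* (n ∸ k)) * (w k * β n n k)))
      ≈⟨ Σ-*ˡ n x _ ⟩
    x * Σ≤ n (λ k → q ^ (e ℕ.* (n ∸ k)) * (w k * β n n k))
      ≈⟨ *-congˡ (Σw n) ⟩
    x * (M n n * H n)
      ≈⟨ solve 3 (λ x m h → x :* (m :* h) := m :* (x :* h)) ≈-refl _ _ _ ⟩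
    M n n * (x * H n) ∎

  -- The weight q^(-ek) w(k) meant here is the same before and after; only the clearing factor grows
  -- by q^n = q^(n-k) q^k. This brings summands with different e to a common one, as `Good-+`
  -- requires.
  Good-q^ : ∀ {e w} → Good e w → Good (suc e) (λ k → q ^ k * w k)
  Good-q^ {e} {w} (good {H} Σw) = good λ n → begin
    Σ≤ n (λ k → q ^ (n ∸ k ℕ.+ e ℕ.* (n ∸ k)) * (q ^ k * w k * β n n k))
      ≈⟨ Σ-cong n (λ k k≤n → begin
           q ^ (n ∸ k ℕ.+ e ℕ.* (n ∸ k)) * (q ^ k * w k * β n n k)
             ≈⟨ *-congʳ (q^-+ (n ∸ k) _) ⟩
           q ^ (n ∸ k) * q ^ (e ℕ.* (n ∸ k)) * (q ^ k * w k * β n n k)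
             ≈⟨ solve 5 (λ x y z w b → x :* y :* (z :* w :* b) := (x :* z) :* (y :* (w :* b))) ≈-refl _ _ _ _ _ ⟩
           (q ^ (n ∸ k) * q ^ k) * (q ^ (e ℕ.* (n ∸ k)) * (w k * β n n k))
             ≈⟨ *-congʳ (≈-trans (≈-sym (q^-+ (n ∸ k) k)) (q^-≡ (ℕₚ.m∸n+n≡m k≤n))) ⟩
           q ^ n * (q ^ (e ℕ.* (n ∸ k)) * (w k * β n n k)) ∎) ⟩
    Σ≤ n (λ k → q ^ n * (q ^ (e ℕ.* (n ∸ k)) * (w k * β n n k)))
      ≈⟨ Σ-*ˡ n _ _ ⟩
    q ^ n * Σ≤ n (λ k → q ^ (e ℕ.* (n ∸ k)) * (w k * β n n k))
      ≈⟨ *-congˡ (Σw n) ⟩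
    q ^ n * (M n n * H n)
      ≈⟨ solve 3 (λ x m h → x :* (m :* h) := m :* (x :* h)) ≈-refl _ _ _ ⟩
    M n n * (q ^ n * H n) ∎

  []-φ : ∀ n → (1# - q) * [ suc n ] * φ n ≈ φ (suc n)
  []-φ n = ≈-trans (*-congʳ (1-q*[] (suc n))) (*-comm _ _)

  G-absorbʳ : ∀ a b → [ suc b ] * G a (suc b) ≈ [ suc (a ℕ.+ b) ] * G a b
  G-absorbʳ a b = 1-q-cancel (φφ-cancel a b (begin
    (1# - q) * ([ suc b ] * G a (suc b)) * (φ a * φ b)
      ≈⟨ solve 5 (λ o x c f g → o :* (x :* c) :* (f :* g) := c :* (f :* (o :* x :* g))) ≈-refl _ _ _ _ _ ⟩
    G a (suc b) * (φ a * ((1# - q) * [ suc b ] * φ b))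
      ≈⟨ *-congˡ (*-congˡ ([]-φ b)) ⟩
    G a (suc b) * (φ a * φ (suc b))
      ≈⟨ G-φ a (suc b) ⟩
    φ (a ℕ.+ suc b)
      ≡⟨ cong φ (ℕₚ.+-suc a b) ⟩
    φ (suc (a ℕ.+ b))
      ≈⟨ []-φ (a ℕ.+ b) ⟨
    (1# - q) * [ suc (a ℕ.+ b) ] * φ (a ℕ.+ b)
      ≈⟨ *-congˡ (G-φ a b) ⟨
    (1# - q) * [ suc (a ℕ.+ b) ] * (G a b * (φ a * φ b))
      ≈⟨ solve 4 (λ o x c f → o :* x :* (c :* f) := o :* (x :* c) :* f) ≈-refl _ _ _ _ ⟩
    (1# - q) * ([ suc (a ℕ.+ b) ] * G a b) * (φ a * φ b) ∎))

  G-absorbˡ : ∀ a b → [ suc a ] * G (suc a) b ≈ [ suc (a ℕ.+ b) ] * G a b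
  G-absorbˡ a b = begin
    [ suc a ] * G (suc a) b         ≈⟨ *-congˡ (G-sym (suc a) b) ⟩
    [ suc a ] * G b (suc a)         ≈⟨ G-absorbʳ b a ⟩
    [ suc (b ℕ.+ a) ] * G b a       ≈⟨ *-cong (reflexive (cong (λ i → [ suc i ]) (ℕₚ.+-comm b a))) (G-sym b a) ⟩
    [ suc (a ℕ.+ b) ] * G a b       ∎

  G-absorb : ∀ a b → [ suc a ] * [ suc b ] * G (suc a) (suc b) ≈ [ suc (suc (a ℕ.+ b)) ] * [ suc (a ℕ.+ b) ] * G a b
  G-absorb a b = begin
    [ suc a ] * [ suc b ] * G (suc a) (suc b)
      ≈⟨ *-assoc _ _ _ ⟩
    [ suc a ] * ([ suc b ] * G (suc a) (suc b))
      ≈⟨ *-congˡ (G-absorbʳ (suc a) b) ⟩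
    [ suc a ] * ([ suc (suc (a ℕ.+ b)) ] * G (suc a) b)
      ≈⟨ solve 3 (λ x y c → x :* (y :* c) := y :* (x :* c)) ≈-refl _ _ _ ⟩
    [ suc (suc (a ℕ.+ b)) ] * ([ suc a ] * G (suc a) b)
      ≈⟨ *-congˡ (G-absorbˡ a b) ⟩
    [ suc (suc (a ℕ.+ b)) ] * ([ suc (a ℕ.+ b) ] * G a b)
      ≈⟨ *-assoc _ _ _ ⟨
    [ suc (suc (a ℕ.+ b)) ] * [ suc (a ℕ.+ b) ] * G a b ∎

  []-+ : ∀ m n → [ m ℕ.+ n ] ≈ [ m ] + q ^ m * [ n ]
  []-+ zero    n = solve 1 (λ x → x := :0 :+ :1 :* x) ≈-refl _
  []-+ (suc m) n = ≈-trans (+-congˡ (*-congˡ ([]-+ m n)))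
    (solve 4 (λ q x p y → :1 :+ q :* (x :+ p :* y) := :1 :+ q :* x :+ q :* p :* y) ≈-refl q [ m ] (q ^ m) [ n ])

  -- Quadratic identities between q-integers are proved after multiplication by (1-q)^2, which turns
  -- them into polynomial identities in q and powers such as q^k, decided by the ring solver.
  1-q²-cancel : ∀ {x y} → (1# - q) * ((1# - q) * x) ≈ (1# - q) * ((1# - q) * y) → x ≈ y
  1-q²-cancel e = 1-q-cancel (1-q-cancel e)

  1-q²*[][] : ∀ m n → (1# - q) * ((1# - q) * ([ m ] * [ n ])) ≈ (1# - q ^ m) * (1# - q ^ n)
  1-q²*[][] m n = ≈-trans (solve 3 (λ o x y → o :* (o :* (x :* y)) := (o :* x) :* (o :* y)) ≈-refl _ _ _) (*-cong (1-q*[] m) (1-q*[] n))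

  q^-+₃ : ∀ v k → q ^ suc (v ℕ.+ k ℕ.+ k) ≈ q * (q ^ v * q ^ k * q ^ k)
  q^-+₃ v k = *-congˡ (≈-trans (q^-+ (v ℕ.+ k) k) (*-congʳ (q^-+ v k)))

  -- With n = v + k, this is the overview's formula for [k][k+1], multiplied by q^n and with the
  -- negative term moved across.
  []-difference : ∀ v k → q ^ v * ([ k ] * [ suc k ]) + [ v ] * [ suc (v ℕ.+ k ℕ.+ k) ] ≈ [ v ℕ.+ k ] * [ suc (v ℕ.+ k) ]
  []-difference v k = 1-q²-cancel (begin
    (1# - q) * ((1# - q) * (V * ([ k ] * [ suc k ]) + [ v ] * [ suc (v ℕ.+ k ℕ.+ k) ]))
      ≈⟨ solve 4 (λ o V x y → o :* (o :* (V :* x :+ y)) := V :* (o :* (o :* x)) :+ o :* (o :* y)) ≈-refl _ _ _ _ ⟩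
    V * ((1# - q) * ((1# - q) * ([ k ] * [ suc k ]))) + (1# - q) * ((1# - q) * ([ v ] * [ suc (v ℕ.+ k ℕ.+ k) ]))
      ≈⟨ +-cong (*-congˡ (1-q²*[][] k (suc k))) (1-q²*[][] v (suc (v ℕ.+ k ℕ.+ k))) ⟩
    V * ((1# - K) * (1# - q * K)) + (1# - V) * (1# - q ^ suc (v ℕ.+ k ℕ.+ k))
      ≈⟨ +-congˡ (*-congˡ (+-congˡ (-‿cong (q^-+₃ v k)))) ⟩
    V * ((1# - K) * (1# - q * K)) + (1# - V) * (1# - q * (V * K * K))
      ≈⟨ solve 3 (λ q V K → V :* ((:1 :- K) :* (:1 :- q :* K)) :+ (:1 :- V) :* (:1 :- q :* (V :* K :* K))
           := (:1 :- V :* K) :* (:1 :- q :* (V :* K))) ≈-refl q V K ⟩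
    (1# - V * K) * (1# - q * (V * K))
      ≈⟨ *-cong (+-congˡ (-‿cong (q^-+ v k))) (+-congˡ (-‿cong (*-congˡ (q^-+ v k)))) ⟨
    (1# - q ^ (v ℕ.+ k)) * (1# - q ^ suc (v ℕ.+ k))
      ≈⟨ 1-q²*[][] (v ℕ.+ k) (suc (v ℕ.+ k)) ⟨
    (1# - q) * ((1# - q) * ([ v ℕ.+ k ] * [ suc (v ℕ.+ k) ])) ∎)
    where
    V = q ^ v
    K = q ^ k

  Good-[k][k+1] : ∀ {e w} → Good e w → Good (suc e) (λ k → [ k ] * [ suc k ] * w k)
  Good-[k][k+1] {e} {w} (good {H} Σw) = good {quotient = H′} Σ≈
    where
    H′ : ℕ → Carrier
    H′ zero    = 0#
    H′ (suc n) = [ suc n ] * [ suc (suc n) ] * H (suc n) - q ^ e * ([ suc n ] * [ suc n ] * H n)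

    -- `T` is the given summand and `A` the wanted one. `B` is the complement of A in [n][n+1] T;
    -- its factors [n-k] and [n+k+1] are those that absorption into `β n n k` can use.
    T A B : ℕ → ℕ → Carrier
    T n k = q ^ (e ℕ.* (n ∸ k)) * (w k * β n n k)
    A n k = q ^ (suc e ℕ.* (n ∸ k)) * ([ k ] * [ suc k ] * w k * β n n k)
    B n k = [ n ∸ k ] * [ suc (n ℕ.+ k) ] * T n k

    A+B : ∀ n k → k ≤ n → A n k + B n k ≈ [ n ] * [ suc n ] * T n k
    A+B n k k≤n = begin
      A n k + B n k
        ≈⟨ +-congʳ (*-congʳ (q^-+ (n ∸ k) _)) ⟩
      q ^ (n ∸ k) * q ^ (e ℕ.* (n ∸ k)) * ([ k ] * [ suc k ] * w k * β n n k) + B n k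
        ≈⟨ solve 7 (λ x y k w b u v → x :* y :* (k :* w :* b) :+ u :* v :* (y :* (w :* b)) := (x :* k :+ u :* v) :* (y :* (w :* b))) ≈-refl _ _ _ _ _ _ _ ⟩
      (q ^ (n ∸ k) * ([ k ] * [ suc k ]) + [ n ∸ k ] * [ suc (n ℕ.+ k) ]) * T n k
        ≡⟨ cong (λ i → (q ^ (n ∸ k) * ([ k ] * [ suc k ]) + [ n ∸ k ] * [ suc (i ℕ.+ k) ]) * T n k) (ℕₚ.m∸n+n≡m k≤n) ⟨
      (q ^ (n ∸ k) * ([ k ] * [ suc k ]) + [ n ∸ k ] * [ suc (n ∸ k ℕ.+ k ℕ.+ k) ]) * T n k
        ≈⟨ *-congʳ ([]-difference (n ∸ k) k) ⟩
      [ n ∸ k ℕ.+ k ] * [ suc (n ∸ k ℕ.+ k) ] * T n k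
        ≡⟨ cong (λ i → [ i ] * [ suc i ] * T n k) (ℕₚ.m∸n+n≡m k≤n) ⟩
      [ n ] * [ suc n ] * T n k ∎

    -- For N = n + 1 this is [2N+1][2N], the product released when absorption lowers both entries of
    -- `β N N k`. By `M-suc` it lifts M n n back to a multiple of M N N, so the lowered sum is
    -- divisible as well.
    m : ℕ → Carrier
    m n = [ suc (suc n ℕ.+ suc n) ] * [ suc (suc (n ℕ.+ n)) ]

    B-suc : ∀ n k → k ≤ n → B (suc n) k ≈ m n * q ^ e * T n k
    B-suc n k k≤n = begin
      [ suc n ∸ k ] * [ suc (suc n ℕ.+ k) ] * (q ^ (e ℕ.* (suc n ∸ k)) * (w k * β (suc n) (suc n) k))
        ≡⟨ cong₂ (λ i b → [ i ] * [ suc (suc n ℕ.+ k) ] * (q ^ (e ℕ.* i) * (w k * b))) (ℕₚ.+-∸-assoc 1 k≤n)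
             (≡.trans (G∸-∸ _ (ℕₚ.m≤n⇒m≤1+n k≤n)) (cong (λ i → G i (suc (suc n ℕ.+ k))) (ℕₚ.+-∸-assoc 1 k≤n))) ⟩
      [ suc v ] * [ suc (suc n ℕ.+ k) ] * (q ^ (e ℕ.* suc v) * (w k * G (suc v) (suc (suc n ℕ.+ k))))
        ≈⟨ solve 5 (λ x y p w c → x :* y :* (p :* (w :* c)) := p :* (w :* (x :* y :* c))) ≈-refl _ _ _ _ _ ⟩
      q ^ (e ℕ.* suc v) * (w k * ([ suc v ] * [ suc (suc n ℕ.+ k) ] * G (suc v) (suc (suc n ℕ.+ k))))
        ≈⟨ *-cong (≈-trans (q^-≡ (ℕₚ.*-suc e v)) (q^-+ e (e ℕ.* v))) (*-congˡ (G-absorb v (suc n ℕ.+ k))) ⟩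
      q ^ e * q ^ (e ℕ.* v) * (w k * ([ suc (suc (v ℕ.+ (suc n ℕ.+ k))) ] * [ suc (v ℕ.+ (suc n ℕ.+ k)) ] * G v (suc n ℕ.+ k)))
        ≡⟨ cong₂ (λ i b → q ^ e * q ^ (e ℕ.* v) * (w k * ([ suc (suc i) ] * [ suc i ] * b))) index (≡.sym (G∸-∸ _ k≤n)) ⟩
      q ^ e * q ^ (e ℕ.* v) * (w k * ([ suc (suc (suc (n ℕ.+ n))) ] * [ suc (suc (n ℕ.+ n)) ] * β n n k))
        ≡⟨ cong (λ i → q ^ e * q ^ (e ℕ.* v) * (w k * ([ suc (suc i) ] * [ suc (suc (n ℕ.+ n)) ] * β n n k))) (≡.sym (ℕₚ.+-suc n n)) ⟩
      q ^ e * q ^ (e ℕ.* v) * (w k * (m n * β n n k))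
        ≈⟨ solve 5 (λ x y w m b → x :* y :* (w :* (m :* b)) := m :* x :* (y :* (w :* b))) ≈-refl _ _ _ _ _ ⟩
      m n * q ^ e * T n k ∎
      where
      v = n ∸ k
      index : v ℕ.+ (suc n ℕ.+ k) ≡ suc (n ℕ.+ n)
      index = ≡.trans (solveℕ 3 (λ v n k → v ⊕ (con′ 1 ⊕ n ⊕ k) ⊜ con′ 1 ⊕ (n ⊕ (v ⊕ k))) refl v n k) (cong (λ i → suc (n ℕ.+ i)) (ℕₚ.m∸n+n≡m k≤n))

    M-suc : ∀ n → m n * M n n ≈ M (suc n) (suc n) * ([ suc n ] * [ suc n ])
    M-suc n = begin
      [ suc (suc n ℕ.+ suc n) ] * [ suc (suc (n ℕ.+ n)) ] * ([ suc (n ℕ.+ n) ] * G n n)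
        ≈⟨ solve 4 (λ x y z c → x :* y :* (z :* c) := x :* (y :* z :* c)) ≈-refl _ _ _ _ ⟩
      [ suc (suc n ℕ.+ suc n) ] * ([ suc (suc (n ℕ.+ n)) ] * [ suc (n ℕ.+ n) ] * G n n)
        ≈⟨ *-congˡ (G-absorb n n) ⟨
      [ suc (suc n ℕ.+ suc n) ] * ([ suc n ] * [ suc n ] * G (suc n) (suc n))
        ≈⟨ solve 3 (λ x y c → x :* (y :* c) := x :* c :* y) ≈-refl _ _ _ ⟩
      M (suc n) (suc n) * ([ suc n ] * [ suc n ]) ∎

    ΣB : ∀ n → Σ≤ (suc n) (B (suc n)) ≈ M (suc n) (suc n) * (q ^ e * ([ suc n ] * [ suc n ] * H n))
    ΣB n = begin
      Σ≤ n (B (suc n)) + B (suc n) (suc n)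
        ≈⟨ +-cong (Σ-cong n (B-suc n)) (zeroˡ′ (zeroˡ′ (reflexive (cong [_] (ℕₚ.n∸n≡0 n))))) ⟩
      Σ≤ n (λ k → m n * q ^ e * T n k) + 0#
        ≈⟨ ≈-trans (+-identityʳ _) (Σ-*ˡ n _ _) ⟩
      m n * q ^ e * Σ≤ n (T n)
        ≈⟨ *-congˡ (Σw n) ⟩
      m n * q ^ e * (M n n * H n)
        ≈⟨ solve 4 (λ m p M H → m :* p :* (M :* H) := m :* M :* (p :* H)) ≈-refl _ _ _ _ ⟩
      m n * M n n * (q ^ e * H n)
        ≈⟨ *-congʳ (M-suc n) ⟩
      M (suc n) (suc n) * ([ suc n ] * [ suc n ]) * (q ^ e * H n)
        ≈⟨ solve 4 (λ M x p H → M :* x :* (p :* H) := M :* (p :* (x :* H))) ≈-refl _ _ _ _ ⟩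
      M (suc n) (suc n) * (q ^ e * ([ suc n ] * [ suc n ] * H n)) ∎

    Σ≈ : ∀ n → Σ≤ n (A n) ≈ M n n * H′ n
    Σ≈ zero    = ≈-trans (zeroʳ′ (zeroˡ′ (zeroˡ′ (zeroˡ _)))) (≈-sym (zeroʳ _))
    Σ≈ (suc n) = begin
      Σ≤ N (A N)
        ≈⟨ solve 2 (λ a b → a := (a :+ b) :- b) ≈-refl _ (Σ≤ N (B N)) ⟩
      (Σ≤ N (A N) + Σ≤ N (B N)) - Σ≤ N (B N)
        ≈⟨ +-cong (≈-trans (≈-sym (Σ-+ N _ _)) (≈-trans (Σ-cong N (A+B N)) (Σ-*ˡ N _ _))) (-‿cong (ΣB n)) ⟩
      [ N ] * [ suc N ] * Σ≤ N (T N) - M N N * (q ^ e * ([ N ] * [ N ] * H n))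
        ≈⟨ +-congʳ (*-congˡ (Σw N)) ⟩
      [ N ] * [ suc N ] * (M N N * H N) - M N N * (q ^ e * ([ N ] * [ N ] * H n))
        ≈⟨ solve 4 (λ x M h y → x :* (M :* h) :- M :* y := M :* (x :* h :- y)) ≈-refl _ _ _ _ ⟩
      M N N * ([ N ] * [ suc N ] * H N - q ^ e * ([ N ] * [ N ] * H n)) ∎
      where
      N = suc n

  [2k+1] : ℕ → Carrier
  [2k+1] k = [ suc (k ℕ.+ k) ]

  -- Let b = [k][k+1]. Then (1-q)^2 b = 1 + q^(2k+1) - (1+q) q^k. Substituting this into (1 -
  -- q^(2k+1))^2 = (1 + q^(2k+1))^2 - 4 q^(2k+1) gives [2k+1]^2 = q^(2k) + 2(1+q) q^k b + (1-q)^2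
  -- b^2. Each term gains two powers of q^(-k): a factor b takes one, a factor q^k is padding for
  -- one.
  Good-[2k+1]² : ∀ {e w} → Good e w → Good (2 ℕ.+ e) (λ k → [2k+1] k * ([2k+1] k * w k))
  Good-[2k+1]² {e} {w} g = Good-cong expand
    (Good-+ (Good-q^ (Good-q^ g))
      (Good-+ (Good-* ((1# + 1#) * (1# + q)) (Good-q^ (Good-[k][k+1] g)))
              (Good-* ((1# - q) * (1# - q)) (Good-[k][k+1] (Good-[k][k+1] g)))))
    where
    square : ∀ k → [2k+1] k * [2k+1] k ≈ q ^ k * q ^ k +
      ((1# + 1#) * (1# + q) * q ^ k * ([ k ] * [ suc k ]) + (1# - q) * (1# - q) * (([ k ] * [ suc k ]) * ([ k ] * [ suc k ])))
    square k = 1-q²-cancel (begin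
      o * (o * ([2k+1] k * [2k+1] k))
        ≈⟨ 1-q²*[][] (suc (k ℕ.+ k)) (suc (k ℕ.+ k)) ⟩
      (1# - q * q ^ (k ℕ.+ k)) * (1# - q * q ^ (k ℕ.+ k))
        ≈⟨ *-cong (+-congˡ (-‿cong (*-congˡ (q^-+ k k)))) (+-congˡ (-‿cong (*-congˡ (q^-+ k k)))) ⟩
      (1# - q * (p * p)) * (1# - q * (p * p))
        ≈⟨ solve 2 (λ q p → let b = (:1 :- p) :* (:1 :- q :* p) in (:1 :- q :* (p :* p)) :* (:1 :- q :* (p :* p))
             := (:1 :- q) :* (:1 :- q) :* (p :* p) :+ ((:1 :+ :1) :* (:1 :+ q) :* p :* b :+ b :* b)) ≈-refl q p ⟩
      o * o * (p * p) + ((1# + 1#) * (1# + q) * p * ((1# - p) * (1# - q * p)) + ((1# - p) * (1# - q * p)) * ((1# - p) * (1# - q * p)))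
        ≈⟨ +-congˡ (+-cong (*-congˡ (1-q²*[][] k (suc k))) (*-cong (1-q²*[][] k (suc k)) (1-q²*[][] k (suc k)))) ⟨
      o * o * (p * p) + ((1# + 1#) * (1# + q) * p * (o * (o * b)) + (o * (o * b)) * (o * (o * b)))
        ≈⟨ solve 4 (λ o x y b → o :* o :* x :+ (y :* (o :* (o :* b)) :+ (o :* (o :* b)) :* (o :* (o :* b)))
             := o :* (o :* (x :+ (y :* b :+ o :* o :* (b :* b))))) ≈-refl o (p * p) _ b ⟩
      o * (o * (p * p + ((1# + 1#) * (1# + q) * p * b + o * o * (b * b)))) ∎)
      where
      o = 1# - q
      p = q ^ k
      b = [ k ] * [ suc k ]
    expand : ∀ k → q ^ k * (q ^ k * w k) +
      ((1# + 1#) * (1# + q) * (q ^ k * ([ k ] * [ suc k ] * w k)) + (1# - q) * (1# - q) * ([ k ] * [ suc k ] * ([ k ] * [ suc k ] * w k)))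
      ≈ [2k+1] k * ([2k+1] k * w k)
    expand k = ≈-trans
      (solve 5 (λ p w y b z → p :* (p :* w) :+ (y :* (p :* (b :* w)) :+ z :* (b :* (b :* w)))
         := (p :* p :+ (y :* p :* b :+ z :* (b :* b))) :* w) ≈-refl (q ^ k) (w k) _ ([ k ] * [ suc k ]) _)
      (≈-trans (*-congʳ (≈-sym (square k))) (*-assoc _ _ _))

  Good-[2k+1]^ : ∀ {e w} r → Good e w → Good (r ℕ.* 2 ℕ.+ e) (λ k → [2k+1] k ^ (r ℕ.* 2) * w k)
  Good-[2k+1]^ zero    g = Good-cong (λ k → ≈-sym (*-identityˡ _)) g
  Good-[2k+1]^ (suc r) g = Good-cong
    (λ k → solve 3 (λ x y w → x :* (x :* (y :* w)) := (x :* (x :* y)) :* w) ≈-refl _ _ _)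
    (Good-[2k+1]² (Good-[2k+1]^ r g))

  Good-q^j[k²+k] : ∀ {e w} j → Good e w → Good e (λ k → q ^ (j ℕ.* (k ℕ.* k ℕ.+ k)) * w k)
  Good-q^j[k²+k] zero    g = Good-cong (λ k → ≈-sym (*-identityˡ _)) g
  Good-q^j[k²+k] (suc j) g = Good-cong
    (λ k → ≈-trans (≈-sym (*-assoc _ _ _)) (*-congʳ (≈-sym (q^-+ (k ℕ.* k ℕ.+ k) _))))
    (Good-q^[k²+k] (Good-q^j[k²+k] j g))

  -- Base cases

  -- t n k is [2n+1] times the q-binomial coefficient with upper entry 2n and lower entry n ∸ k.
  t : ℕ → ℕ → Carrier
  t n k = [ suc (n ℕ.+ n) ] * G∸ n k (n ℕ.+ k)

  t≈ : ∀ n k → k ≤ n → t n k ≈ [ suc (n ℕ.+ k) ] * β n n k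
  t≈ n k k≤n = begin
    [ suc (n ℕ.+ n) ] * G∸ n k (n ℕ.+ k)                 ≡⟨ cong₂ (λ i b → [ suc i ] * b) (≡.sym index) (G∸-∸ _ k≤n) ⟩
    [ suc (n ∸ k ℕ.+ (n ℕ.+ k)) ] * G (n ∸ k) (n ℕ.+ k)  ≈⟨ G-absorbʳ (n ∸ k) (n ℕ.+ k) ⟨
    [ suc (n ℕ.+ k) ] * G (n ∸ k) (suc (n ℕ.+ k))        ≡⟨ cong ([ suc (n ℕ.+ k) ] *_) (G∸-∸ _ k≤n) ⟨
    [ suc (n ℕ.+ k) ] * β n n k                          ∎
    where
    index : n ∸ k ℕ.+ (n ℕ.+ k) ≡ n ℕ.+ n
    index = ≡.trans (solveℕ 3 (λ v n k → v ⊕ (n ⊕ k) ⊜ n ⊕ (v ⊕ k)) refl (n ∸ k) n k) (cong (n ℕ.+_) (ℕₚ.m∸n+n≡m k≤n))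

  -- With `t≈`, it writes t at k and at k + 1 as multiples of the same `β n n k`, so that
  -- telescoping becomes a relation between q-integers.
  t-suc≈ : ∀ n k → k ≤ n → t n (suc k) ≈ [ n ∸ k ] * β n n k
  t-suc≈ n k k≤n with ℕₚ.m≤n⇒m<n∨m≡n k≤n
  ... | inj₂ refl = ≈-trans (zeroʳ′ (reflexive (G∸-< {k} _ ℕₚ.≤-refl))) (≈-sym (zeroˡ′ (reflexive (cong [_] (ℕₚ.n∸n≡0 k)))))
  ... | inj₁ k<n = begin
    [ suc (n ℕ.+ n) ] * G∸ n (suc k) (n ℕ.+ suc k)
      ≡⟨ cong₂ (λ i b → [ suc i ] * b) (≡.sym index) (≡.trans (G∸-∸ _ k<n) (cong (G v) (ℕₚ.+-suc n k))) ⟩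
    [ suc (v ℕ.+ suc (n ℕ.+ k)) ] * G v (suc (n ℕ.+ k))
      ≈⟨ G-absorbˡ v (suc (n ℕ.+ k)) ⟨
    [ suc v ] * G (suc v) (suc (n ℕ.+ k))
      ≡⟨ cong (λ i → [ i ] * G i (suc (n ℕ.+ k))) (ℕₚ.+-∸-assoc 1 k<n) ⟨
    [ n ∸ k ] * G (n ∸ k) (suc (n ℕ.+ k))
      ≡⟨ cong ([ n ∸ k ] *_) (G∸-∸ _ k≤n) ⟨
    [ n ∸ k ] * β n n k ∎
    where
    v = n ∸ suc k
    index : v ℕ.+ suc (n ℕ.+ k) ≡ n ℕ.+ n
    index = ≡.trans (solveℕ 3 (λ v n k → v ⊕ (con′ 1 ⊕ (n ⊕ k)) ⊜ n ⊕ (v ⊕ (con′ 1 ⊕ k))) refl v n k) (cong (n ℕ.+_) (ℕₚ.m∸n+n≡m k<n))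

  -- The summand is t n k - t n (k+1), because [n-k] + q^(n-k) [2k+1] = [n+k+1]. The sum is
  -- therefore t n 0, which is M n n itself, so the quotient is 1.
  Good-base : Good 1 [2k+1]
  Good-base = good {quotient = λ _ → 1#} Σ≈
    where
    Σ≈ : ∀ n → Σ≤ n (λ k → q ^ (1 ℕ.* (n ∸ k)) * ([2k+1] k * β n n k)) ≈ M n n * 1#
    Σ≈ n = begin
      Σ≤ n f                        ≈⟨ +-identityʳ _ ⟨
      Σ≤ n f + 0#                   ≈⟨ +-congˡ (zeroʳ′ (reflexive (G∸-< {n} _ ℕₚ.≤-refl))) ⟨
      Σ≤ n f + t n (suc n)          ≈⟨ Σ-telescope n f (λ _ → 0#) (t n) telescope ⟩
      Σ≤ n (λ _ → 0#) + t n 0       ≈⟨ +-congʳ (Σ-zero n λ _ _ → ≈-refl) ⟩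
      0# + t n 0                    ≈⟨ +-identityˡ _ ⟩
      [ suc (n ℕ.+ n) ] * G n (n ℕ.+ 0) ≡⟨ cong (λ i → [ suc (n ℕ.+ n) ] * G n i) (ℕₚ.+-identityʳ n) ⟩
      M n n                         ≈⟨ *-identityʳ _ ⟨
      M n n * 1#                    ∎
      where
      f : ℕ → Carrier
      f k = q ^ (1 ℕ.* (n ∸ k)) * ([2k+1] k * β n n k)
      telescope : ∀ k → k ≤ n → f k + t n (suc k) ≈ 0# + t n k
      telescope k k≤n = begin
        f k + t n (suc k)
          ≈⟨ +-cong (*-congʳ (q^-≡ (ℕₚ.*-identityˡ (n ∸ k)))) (t-suc≈ n k k≤n) ⟩
        q ^ (n ∸ k) * ([2k+1] k * β n n k) + [ n ∸ k ] * β n n k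
          ≈⟨ solve 4 (λ p x b y → p :* (x :* b) :+ y :* b := (y :+ p :* x) :* b) ≈-refl _ _ _ _ ⟩
        ([ n ∸ k ] + q ^ (n ∸ k) * [2k+1] k) * β n n k
          ≈⟨ *-congʳ ([]-+ (n ∸ k) (suc (k ℕ.+ k))) ⟨
        [ n ∸ k ℕ.+ suc (k ℕ.+ k) ] * β n n k
          ≡⟨ cong (λ i → [ i ] * β n n k) (≡.trans (solveℕ 2 (λ v k → v ⊕ (con′ 1 ⊕ (k ⊕ k)) ⊜ con′ 1 ⊕ (v ⊕ k ⊕ k)) refl (n ∸ k) k) (cong (λ i → suc (i ℕ.+ k)) (ℕₚ.m∸n+n≡m k≤n))) ⟩
        [ suc (n ℕ.+ k) ] * β n n k
          ≈⟨ t≈ n k k≤n ⟨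
        t n k
          ≈⟨ +-identityˡ _ ⟨
        0# + t n k ∎

  suc-C-2 : ∀ k → suc k C 2 ≡ k C 2 ℕ.+ k
  suc-C-2 k = ≡.trans (≡.sym (nCk+nC[k+1]≡[n+1]C[k+1] k 1)) (≡.trans (cong (ℕ._+ k C 2) (nC1≡n k)) (ℕₚ.+-comm k _))

  sgn : ℕ → Carrier
  sgn zero    = 1#
  sgn (suc k) = - sgn k

  -- The sum is 1 at n = 0 and vanishes for n > 0, hence the quotient `δ`. The telescoping partner
  -- would carry a denominator [n], so [n] times the sum is shown to vanish and [n] is cancelled.
  Good-base-alternating : Good 0 (λ k → sgn k * q ^ (k C 2) * [2k+1] k)
  Good-base-alternating = good {quotient = δ} Σ≈
    where
    δ : ℕ → Carrier
    δ zero    = 1#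
    δ (suc n) = 0#
    Σ≈ : ∀ n → Σ≤ n (λ k → 1# * (sgn k * q ^ (k C 2) * [2k+1] k * β n n k)) ≈ M n n * δ n
    Σ≈ zero    = solve 1 (λ q → let s = :1 :+ q :* :0 in :1 :* (:1 :* :1 :* s :* :1) := s :* :1 :* :1) ≈-refl q
    Σ≈ (suc n) = ≈-trans ([]-cancel n (≈-trans nΣ≈0 (≈-sym (zeroʳ _)))) (≈-sym (zeroʳ _))
      where
      N = suc n
      -- The factor [k] makes h vanish at 0, and `t N k` makes it vanish at N + 1: nothing remains
      -- at either end.
      f h : ℕ → Carrier
      f k = 1# * (sgn k * q ^ (k C 2) * [2k+1] k * β N N k)
      h k = sgn k * q ^ (k C 2) * [ k ] * t N k
      identity : ∀ v k → [ v ℕ.+ k ] * [2k+1] k ≈ [ k ] * [ suc (v ℕ.+ k ℕ.+ k) ] + q ^ k * [ suc k ] * [ v ]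
      identity v k = 1-q²-cancel (begin
        (1# - q) * ((1# - q) * ([ v ℕ.+ k ] * [2k+1] k))
          ≈⟨ 1-q²*[][] (v ℕ.+ k) (suc (k ℕ.+ k)) ⟩
        (1# - q ^ (v ℕ.+ k)) * (1# - q * q ^ (k ℕ.+ k))
          ≈⟨ *-cong (+-congˡ (-‿cong (q^-+ v k))) (+-congˡ (-‿cong (*-congˡ (q^-+ k k)))) ⟩
        (1# - V * K) * (1# - q * (K * K))
          ≈⟨ solve 3 (λ q V K → (:1 :- V :* K) :* (:1 :- q :* (K :* K))
               := (:1 :- K) :* (:1 :- q :* (V :* K :* K)) :+ K :* ((:1 :- q :* K) :* (:1 :- V))) ≈-refl q V K ⟩
        (1# - K) * (1# - q * (V * K * K)) + K * ((1# - q * K) * (1# - V))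
          ≈⟨ +-congʳ (*-congˡ (+-congˡ (-‿cong (q^-+₃ v k)))) ⟨
        (1# - K) * (1# - q ^ suc (v ℕ.+ k ℕ.+ k)) + K * ((1# - q * K) * (1# - V))
          ≈⟨ +-cong (1-q²*[][] k (suc (v ℕ.+ k ℕ.+ k))) (*-congˡ (1-q²*[][] (suc k) v)) ⟨
        (1# - q) * ((1# - q) * ([ k ] * [ suc (v ℕ.+ k ℕ.+ k) ])) + K * ((1# - q) * ((1# - q) * ([ suc k ] * [ v ])))
          ≈⟨ solve 5 (λ o x K y z → o :* (o :* x) :+ K :* (o :* (o :* (y :* z))) := o :* (o :* (x :+ K :* y :* z))) ≈-refl _ _ _ _ _ ⟩
        (1# - q) * ((1# - q) * ([ k ] * [ suc (v ℕ.+ k ℕ.+ k) ] + K * [ suc k ] * [ v ])) ∎)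
        where
        V = q ^ v
        K = q ^ k
      telescope : ∀ k → k ≤ N → [ N ] * f k + h (suc k) ≈ 0# + h k
      telescope k k≤N = begin
        [ N ] * f k + h (suc k)
          ≈⟨ +-congˡ (*-cong (*-congʳ (*-congˡ (≈-trans (q^-≡ (suc-C-2 k)) (q^-+ (k C 2) k)))) (t-suc≈ N k k≤N)) ⟩
        [ N ] * f k + - sgn k * (q ^ (k C 2) * q ^ k) * [ suc k ] * ([ N ∸ k ] * β N N k)
          ≈⟨ solve 8 (λ N s Q x b p y v → N :* (:1 :* (s :* Q :* x :* b)) :+ :- s :* (Q :* p) :* y :* (v :* b)
               := s :* Q :* b :* (N :* x) :- s :* Q :* b :* (p :* y :* v)) ≈-refl _ _ _ _ _ _ _ _ ⟩
        sgn k * q ^ (k C 2) * β N N k * ([ N ] * [2k+1] k) - sgn k * q ^ (k C 2) * β N N k * (q ^ k * [ suc k ] * [ N ∸ k ])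
          ≈⟨ +-congʳ (*-congˡ identity′) ⟩
        sgn k * q ^ (k C 2) * β N N k * ([ k ] * [ suc (N ℕ.+ k) ] + q ^ k * [ suc k ] * [ N ∸ k ]) - sgn k * q ^ (k C 2) * β N N k * (q ^ k * [ suc k ] * [ N ∸ k ])
          ≈⟨ solve 6 (λ s Q b x y z → s :* Q :* b :* (x :* y :+ z) :- s :* Q :* b :* z := s :* Q :* x :* (y :* b)) ≈-refl _ _ _ _ _ _ ⟩
        sgn k * q ^ (k C 2) * [ k ] * ([ suc (N ℕ.+ k) ] * β N N k)
          ≈⟨ *-congˡ (t≈ N k k≤N) ⟨
        h k
          ≈⟨ +-identityˡ _ ⟨
        0# + h k ∎
        where
        identity′ : [ N ] * [2k+1] k ≈ [ k ] * [ suc (N ℕ.+ k) ] + q ^ k * [ suc k ] * [ N ∸ k ]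
        identity′ = ≡.subst (λ i → [ i ] * [2k+1] k ≈ [ k ] * [ suc (i ℕ.+ k) ] + q ^ k * [ suc k ] * [ N ∸ k ]) (ℕₚ.m∸n+n≡m k≤N) (identity (N ∸ k) k)
      nΣ≈0 : [ N ] * Σ≤ N f ≈ 0#
      nΣ≈0 = begin
        [ N ] * Σ≤ N f                          ≈⟨ Σ-*ˡ N _ _ ⟨
        Σ≤ N (λ k → [ N ] * f k)                ≈⟨ +-identityʳ _ ⟨
        Σ≤ N (λ k → [ N ] * f k) + 0#           ≈⟨ +-congˡ (zeroʳ′ (zeroʳ′ (reflexive (G∸-< {N} _ ℕₚ.≤-refl)))) ⟨
        Σ≤ N (λ k → [ N ] * f k) + h (suc N)    ≈⟨ Σ-telescope N _ (λ _ → 0#) h telescope ⟩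
        Σ≤ N (λ _ → 0#) + h 0                   ≈⟨ +-cong (Σ-zero N λ _ _ → ≈-refl) (zeroˡ′ (zeroʳ _)) ⟩
        0# + 0#                                 ≈⟨ +-identityˡ _ ⟩
        0#                                      ∎

  -- Cyclic products

  Π : ℕ → (ℕ → Carrier) → Carrier
  Π zero    f = 1#
  Π (suc m) f = Π m f * f (suc m)

  Π-cong : ∀ m {f g} → (∀ i → f i ≈ g i) → Π m f ≈ Π m g
  Π-cong zero    e = ≈-refl
  Π-cong (suc m) e = *-cong (Π-cong m e) (e (suc m))

  Π-peel : ∀ m f → Π (suc m) f ≈ f 1 * Π m (λ i → f (suc i))
  Π-peel zero    f = *-comm _ _
  Π-peel (suc m) f = ≈-trans (*-congʳ (Π-peel m f)) (*-assoc _ _ _)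

  Πβ : ℕ → (ℕ → ℕ) → ℕ → Carrier
  Πβ m n k = Π m (λ i → β (n i) (n (suc i)) k)

  GoodPair-cong : ∀ {e d f w w′} → (∀ k → w k ≈ w′ k) → GoodPair e d f w → GoodPair e d f w′
  GoodPair-cong w≈w′ (goodPair Σw) = goodPair λ a → ≈-trans (Σ-cong a λ k _ → *-congˡ (*-congʳ (≈-sym (w≈w′ k)))) (Σw a)

  -- The vertices n 1, ..., n (l+1) form a path, and the vertex a that closes it to a cycle stays
  -- free. Vertices are added at the front, so the last one, which determines the modulus, is the
  -- same throughout.
  GoodPair-path : ∀ {e w} → Good e w → ∀ l n → GoodPair e (n 1) (n (suc l)) (λ k → Πβ l n k * w k)
  GoodPair-path g zero    n = GoodPair-cong (λ k → ≈-sym (*-identityˡ _)) (Good⇒GoodPair (n 1) g)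
  GoodPair-path g (suc l) n = GoodPair-cong
    (λ k → ≈-sym (≈-trans (*-congʳ (Π-peel l _)) (*-assoc _ _ _)))
    (GoodPair-step (n 1) (GoodPair-path g l (λ i → n (suc i))))

  Good⇒cycle : ∀ {e w} → Good e w → ∀ m n → n (suc (suc m)) ≡ n 1 →
    ∃ λ Y → Σ≤ (n 1) (λ k → q ^ (e ℕ.* (n 1 ∸ k)) * (w k * Πβ (suc m) n k)) ≈ M (n 1) (n (suc m)) * Y
  Good⇒cycle (good Σw) zero n n₂≡n₁ = _ , ≈-trans
    (Σ-cong (n 1) λ k _ → *-congˡ (*-congˡ (≈-trans (*-identityˡ _) (reflexive (cong (λ i → β (n 1) i k) n₂≡n₁)))))
    (Σw (n 1))
  -- The cycle is cut at n 1, which becomes the free vertex; the remaining vertices from n 2 on form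
  -- the path. The first and last factors of the product are the two that meet n 1.
  Good⇒cycle {e} {w} g (suc m) n closed with GoodPair-path g m (λ i → n (suc i))
  ... | goodPair Σw = _ , ≈-trans (Σ-cong (n 1) λ k _ → *-congˡ (begin
      w k * (Πβ (suc m) n k * β (n (suc (suc m))) (n (suc (suc (suc m)))) k)
        ≈⟨ *-congˡ (*-cong (Π-peel m _) (reflexive (cong (λ i → β (n (suc (suc m))) i k) closed))) ⟩
      w k * (β (n 1) (n 2) k * Πβ m (λ i → n (suc i)) k * β (n (suc (suc m))) (n 1) k)
        ≈⟨ solve 4 (λ w x y z → w :* (x :* y :* z) := y :* w :* (x :* z)) ≈-refl _ _ _ _ ⟩
      Πβ m (λ i → n (suc i)) k * w k * (β (n 1) (n 2) k * β (n (suc (suc m))) (n 1) k) ∎)) (Σw (n 1))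

  -- Negative powers of q

  -- The Laurent polynomial q ^ (- s) * p equals q ^ (- N) * x.
  record Cleared (N s : ℕ) (p x : Carrier) : Set ℓ where
    constructor cleared
    field
      clear : q ^ N * p ≈ q ^ s * x

  Cleared-cong : ∀ {N s p p′ x x′} → p ≈ p′ → x ≈ x′ → Cleared N s p x → Cleared N s p′ x′
  Cleared-cong p≈p′ x≈x′ (cleared e) = cleared (≈-trans (*-congˡ (≈-sym p≈p′)) (≈-trans e (*-congˡ x≈x′)))

  Cleared-+ : ∀ {N s t p r x y} → Cleared N s p x → Cleared N t r y →
    Cleared N (s ℕ.⊔ t) (q ^ (s ℕ.⊔ t ∸ s) * p + q ^ (s ℕ.⊔ t ∸ t) * r) (x + y)
  Cleared-+ {N} {s} {t} {p} {r} {x} {y} (cleared e) (cleared f) = cleared (begin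
    q ^ N * (q ^ (m ∸ s) * p + q ^ (m ∸ t) * r)
      ≈⟨ solve 5 (λ n a b p r → n :* (a :* p :+ b :* r) := a :* (n :* p) :+ b :* (n :* r)) ≈-refl _ _ _ _ _ ⟩
    q ^ (m ∸ s) * (q ^ N * p) + q ^ (m ∸ t) * (q ^ N * r)
      ≈⟨ +-cong (*-congˡ e) (*-congˡ f) ⟩
    q ^ (m ∸ s) * (q ^ s * x) + q ^ (m ∸ t) * (q ^ t * y)
      ≈⟨ +-cong (join (ℕₚ.m≤m⊔n s t)) (join (ℕₚ.m≤n⊔m s t)) ⟩
    q ^ m * x + q ^ m * y
      ≈⟨ distribˡ _ _ _ ⟨
    q ^ m * (x + y) ∎)
    where
    m = s ℕ.⊔ t
    join : ∀ {i z} → i ≤ m → q ^ (m ∸ i) * (q ^ i * z) ≈ q ^ m * z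
    join {i} i≤m = ≈-trans (≈-sym (*-assoc _ _ _)) (*-congʳ (≈-trans (≈-sym (q^-+ (m ∸ i) i)) (q^-≡ (ℕₚ.m∸n+n≡m i≤m))))

  Cleared-*ˡ : ∀ {N s p x} z → Cleared N s p x → Cleared N s (z * p) (z * x)
  Cleared-*ˡ z (cleared e) = cleared (≈-trans (solve 3 (λ n z p → n :* (z :* p) := z :* (n :* p)) ≈-refl _ _ _)
    (≈-trans (*-congˡ e) (solve 3 (λ z s x → z :* (s :* x) := s :* (z :* x)) ≈-refl _ _ _)))

  Cleared-** : ∀ {N s p x} y z → Cleared N s p x → Cleared N s (p * y * z) (x * y * z)
  Cleared-** y z (cleared e) = cleared (≈-trans (solve 4 (λ n p y z → n :* (p :* y :* z) := n :* p :* y :* z) ≈-refl _ _ _ _)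
    (≈-trans (*-congʳ (*-congʳ e)) (solve 4 (λ s x y z → s :* x :* y :* z := s :* (x :* y :* z)) ≈-refl _ _ _ _)))

  -- Sums need one clearing exponent N for all terms. Raising ek by e(n-k) gives the common value
  -- en, and the extra power q^(e(n-k)) is precisely the one in `Good`.
  Cleared-raise : ∀ {N s p x} i → Cleared N s p x → Cleared (N ℕ.+ i) s p (q ^ i * x)
  Cleared-raise {N} i (cleared e) = cleared (≈-trans (*-congʳ (q^-+ N i))
    (≈-trans (solve 3 (λ n i p → n :* i :* p := i :* (n :* p)) ≈-refl _ _ _)
    (≈-trans (*-congˡ e) (solve 3 (λ i s x → i :* (s :* x) := s :* (i :* x)) ≈-refl _ _ _))))

  -- Moves the sign and q^i from the outside, where the summand of the theorem has them, to the
  -- innermost weight, where `Good-base-alternating` has them.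
  sgn-inside : ∀ i j k x y z u → sgn k * (z * (q ^ (i ℕ.+ j) * (x * y) * u)) ≈ z * (q ^ j * (x * (sgn k * q ^ i * y)) * u)
  sgn-inside i j k x y z u = ≈-trans (*-congˡ (*-congˡ (*-congʳ (*-congʳ (q^-+ i j)))))
    (solve 7 (λ s z a b x y u → s :* (z :* (a :* b :* (x :* y) :* u)) := z :* (b :* (x :* (s :* a :* y)) :* u)) ≈-refl _ _ _ _ _ _ _)

  numerator-lemma : ∀ {x y a} → a * φ y ≈ φ (x ℕ.+ y) → φ x * G x y ≈ a
  numerator-lemma {x} {y} {a} e = φ-cancel y (begin
    φ y * (φ x * G x y)     ≈⟨ solve 3 (λ f g c → f :* (g :* c) := c :* (g :* f)) ≈-refl _ _ _ ⟩
    G x y * (φ x * φ y)     ≈⟨ G-φ x y ⟩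
    φ (x ℕ.+ y)             ≈⟨ e ⟨
    a * φ y                 ≈⟨ *-comm _ _ ⟩
    φ y * a                 ∎)

-- The q-series results for integer polynomials, with q the indeterminate

module PolynomialQSeries where
  open PolynomialRing
  open CommutativeRing polyRing using (*-congˡ; *-congʳ; *-cong; +-cong; *-assoc; *-comm; *-identityʳ; *-identityˡ; reflexive; zeroʳ; distribˡ; -‿cong)
    renaming (refl to ≋-refl; sym to ≋-sym; trans to ≋-trans)
  open Exp (CommutativeRing.commutativeSemiring polyRing) using (_^_; ^-congˡ)
  open SetoidReasoning polySetoid

  constants : ℤ.+-*-rawRing -Raw-AlmostCommutative⟶ fromCommutativeRing polyRing
  constants = record
    { ⟦_⟧    = λ c → c ∷ []
    ; +-homo = λ c d → ≋-refl
    ; *-homo = λ c d → ≋-sym (const-*ₚ c (d ∷ []))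
    ; -‿homo = λ c → ∷-cong (≡.sym (ℤₚ.-1*i≡-i c)) ≋-refl
    ; 0-homo = 0∷[]≋[]
    ; 1-homo = ≋-refl
    }

  X : Poly
  X = + 0 ∷ oneₚ

  X-* : ∀ p → X *ₚ p ≋ (+ 0 ∷ p)
  X-* p = ≋-trans (0∷-*ₚ oneₚ p) (∷-cong refl (*ₚ-identityˡ p))

  coeff₀-*ₚ : ∀ p r → coeff (p *ₚ r) 0 ≡ coeff p 0 ℤ.* coeff r 0
  coeff₀-*ₚ []      r = refl
  coeff₀-*ₚ (a ∷ p) r = ≡.trans (coeff-+ₚ (scaleₚ a r) _ 0) (≡.trans (ℤₚ.+-identityʳ _) (coeff-scaleₚ a r 0))

  -- Since b has constant term 1, the constant term of the product is that of z, which is therefore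
  -- 0; one power of q is then removed and the argument repeated.
  *ₚ≋[]⇒≋[] : ∀ b z → coeff b 0 ≡ + 1 → b *ₚ z ≋ [] → z ≋ []
  *ₚ≋[]⇒≋[] b []      b₀ e = ≋-refl
  *ₚ≋[]⇒≋[] b (c ∷ z) b₀ e = ≋-trans (∷-cong c≡0 (*ₚ≋[]⇒≋[] b z b₀ (tail-≋[] bz≋[]))) 0∷[]≋[]
    where
    c≡0 : c ≡ + 0
    c≡0 = ≡.trans (≡.sym (≡.trans (coeff₀-*ₚ b (c ∷ z)) (≡.trans (cong (ℤ._* c) b₀) (ℤₚ.*-identityˡ c)))) (at e 0)
    bz≋[] : (+ 0 ∷ (b *ₚ z)) ≋ []
    bz≋[] = begin
      [] +ₚ (+ 0 ∷ (b *ₚ z))          ≈⟨ +ₚ-cong (≋-trans (scaleₚ-cong c≡0 (≋-refl {b})) (scaleₚ-zero b)) ≋-refl ⟨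
      scaleₚ c b +ₚ (+ 0 ∷ (b *ₚ z))  ≈⟨ *ₚ-∷ b c z ⟨
      b *ₚ (c ∷ z)                    ≈⟨ e ⟩
      []                              ∎

  *ₚ-cancelˡ : ∀ b {x y} → coeff b 0 ≡ + 1 → b *ₚ x ≋ b *ₚ y → x ≋ y
  *ₚ-cancelˡ b {x} {y} b₀ e = R.x∙y⁻¹≈ε⇒x≈y x y (*ₚ≋[]⇒≋[] b (x -ₚ y) b₀ (begin
    b *ₚ (x -ₚ y)             ≈⟨ distribˡ b x (negₚ y) ⟩
    b *ₚ x +ₚ b *ₚ negₚ y     ≈⟨ +ₚ-cong ≋-refl (R.-‿distribʳ-* b y) ⟨
    b *ₚ x -ₚ b *ₚ y          ≈⟨ +ₚ-cong e ≋-refl ⟩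
    b *ₚ y -ₚ b *ₚ y          ≈⟨ CommutativeRing.-‿inverseʳ polyRing (b *ₚ y) ⟩
    []                        ∎))
    where
    module R = Algebra.Properties.Ring (CommutativeRing.ring polyRing)

  coeff₀-1-X^ : ∀ n → coeff (oneₚ -ₚ X ^ suc n) 0 ≡ + 1
  coeff₀-1-X^ n = ≡.trans (coeff-+ₚ oneₚ (negₚ (X ^ suc n)) 0)
    (cong (ℤ._+_ (+ 1)) (≡.trans (coeff-scaleₚ _ (X ^ suc n) 0) (cong (ℤ._*_ (ℤ.- (+ 1))) (coeff₀-*ₚ X (X ^ n)))))

  open QSeries polyRing constants X (λ n → *ₚ-cancelˡ (oneₚ -ₚ X ^ suc n) (coeff₀-1-X^ n)) public

  shiftₚ≋ : ∀ n p → shiftₚ n p ≋ X ^ n *ₚ p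
  shiftₚ≋ zero    p = ≋-sym (*-identityˡ p)
  shiftₚ≋ (suc n) p = begin
    + 0 ∷ shiftₚ n p         ≈⟨ X-* (shiftₚ n p) ⟨
    X *ₚ shiftₚ n p          ≈⟨ *-congˡ {X} (shiftₚ≋ n p) ⟩
    X *ₚ (X ^ n *ₚ p)        ≈⟨ *-assoc X (X ^ n) p ⟨
    X *ₚ X ^ n *ₚ p          ∎

  qpow≋ : ∀ n → qpow n ≋ X ^ n
  qpow≋ n = ≋-trans (shiftₚ≋ n oneₚ) (*-identityʳ (X ^ n))

  qint≋ : ∀ n → qint n ≋ [ n ]
  qint≋ zero    = ≋-refl
  qint≋ (suc n) = +-cong (≋-refl {oneₚ}) (≋-trans (∷-cong refl (qint≋ n)) (≋-sym (X-* [ n ])))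

  oneMinusQ≋ : ∀ n → oneMinusQ n ≋ oneₚ -ₚ X ^ n
  oneMinusQ≋ n = +-cong (≋-refl {oneₚ}) (-‿cong (qpow≋ n))

  prodₚ≡Π : ∀ m f → prodₚ m f ≡ Π m f
  prodₚ≡Π zero    f = refl
  prodₚ≡Π (suc m) f = cong (_*ₚ f (suc m)) (prodₚ≡Π m f)

  ^ₚ≡^ : ∀ p n → p ^ₚ n ≡ p ^ n
  ^ₚ≡^ p zero    = refl
  ^ₚ≡^ p (suc n) = cong (p *ₚ_) (^ₚ≡^ p n)

  -- Exact division

  coeff-drop : ∀ p i → coeff (drop 1 p) i ≡ coeff p (suc i)
  coeff-drop []      i = refl
  coeff-drop (a ∷ p) i = refl

  coeff-length : ∀ p {i} → length p ≤ i → coeff p i ≡ + 0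
  coeff-length []      l≤i       = refl
  coeff-length (a ∷ p) (s≤s l≤i) = coeff-length p l≤i

  length-divLow : ∀ n a b → length (divLow n a b) ≡ n
  length-divLow zero    a b = refl
  length-divLow (suc n) a b = cong suc (length-divLow n _ b)

  -- The invariant is that the dividend equals b times the part of g not yet produced; constant term
  -- 1 makes the next coefficient of g the constant term of the dividend.
  divLow-exact : ∀ n a b g → coeff b 0 ≡ + 1 → b *ₚ g ≋ a → ∀ i → i < n → coeff (divLow n a b) i ≡ coeff g i
  divLow-exact (suc n) a b g b₀ e = λ { zero _ → a₀≡g₀ ; (suc i) (s≤s i<n) →
      ≡.trans (divLow-exact n _ b (drop 1 g) b₀ tail-exact i i<n) (coeff-drop g i) }
    where
    a₀≡g₀ : coeff a 0 ≡ coeff g 0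
    a₀≡g₀ = ≡.trans (≡.sym (at e 0)) (≡.trans (coeff₀-*ₚ b g) (≡.trans (cong (ℤ._* coeff g 0) b₀) (ℤₚ.*-identityˡ _)))
    cons : g ≋ (coeff g 0 ∷ drop 1 g)
    cons = mk λ { zero → refl ; (suc i) → ≡.sym (coeff-drop g i) }
    a≋ : a ≋ scaleₚ (coeff a 0) b +ₚ (+ 0 ∷ (b *ₚ drop 1 g))
    a≋ = begin
      a                                                       ≈⟨ e ⟨
      b *ₚ g                                                  ≈⟨ *ₚ-congˡ b cons ⟩
      b *ₚ (coeff g 0 ∷ drop 1 g)                             ≈⟨ *ₚ-∷ b (coeff g 0) (drop 1 g) ⟩
      scaleₚ (coeff g 0) b +ₚ (+ 0 ∷ (b *ₚ drop 1 g))         ≈⟨ +ₚ-cong (scaleₚ-cong a₀≡g₀ (≋-refl {b})) ≋-refl ⟨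
      scaleₚ (coeff a 0) b +ₚ (+ 0 ∷ (b *ₚ drop 1 g))         ∎
    remainder : a -ₚ scaleₚ (coeff a 0) b ≋ (+ 0 ∷ (b *ₚ drop 1 g))
    remainder = begin
      a -ₚ s                    ≈⟨ +ₚ-cong (≋-trans a≋ (+ₚ-comm s h)) (≋-refl {negₚ s}) ⟩
      (h +ₚ s) -ₚ s             ≈⟨ +ₚ-assoc h s (negₚ s) ⟩
      h +ₚ (s -ₚ s)             ≈⟨ +ₚ-cong (≋-refl {h}) (CommutativeRing.-‿inverseʳ polyRing s) ⟩
      h +ₚ []                   ≈⟨ +ₚ-identityʳ h ⟩
      h                         ∎
      where
      s = scaleₚ (coeff a 0) b
      h = + 0 ∷ (b *ₚ drop 1 g)
    tail-exact : b *ₚ drop 1 g ≋ drop 1 (a -ₚ scaleₚ (coeff a 0) b)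
    tail-exact = mk λ i → ≡.sym (≡.trans (coeff-drop (a -ₚ scaleₚ (coeff a 0) b) i) (at remainder (suc i)))

  -- The division stops after `length a` coefficients, so it also has to be known that g has none
  -- beyond. `length` belongs to the list, which may have trailing zeros, and is not a degree.
  divₚ-exact : ∀ a b g → coeff b 0 ≡ + 1 → b *ₚ g ≋ a → (∀ i → length a ≤ i → coeff g i ≡ + 0) → divₚ a b ≋ g
  divₚ-exact a b g b₀ e g-bound = mk coeffs
    where
    coeffs : ∀ i → coeff (divₚ a b) i ≡ coeff g i
    coeffs i with i ℕ.<? length a
    ... | yes i<l = divLow-exact (length a) a b g b₀ e i i<l
    ... | no  i≮l = ≡.trans (coeff-length (divₚ a b) (ℕₚ.≤-trans (ℕₚ.≤-reflexive (length-divLow (length a) a b)) l≤i)) (≡.sym (g-bound i l≤i))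
      where l≤i = ℕₚ.≮⇒≥ i≮l

  -- Lengths and degrees

  length-scaleₚ : ∀ c p → length (scaleₚ c p) ≡ length p
  length-scaleₚ c []      = refl
  length-scaleₚ c (a ∷ p) = cong suc (length-scaleₚ c p)

  length-+ₚˡ : ∀ p r → length p ≤ length (p +ₚ r)
  length-+ₚˡ []      r       = z≤n
  length-+ₚˡ (a ∷ p) []      = ℕₚ.≤-refl
  length-+ₚˡ (a ∷ p) (b ∷ r) = s≤s (length-+ₚˡ p r)

  length-+ₚʳ : ∀ p r → length r ≤ length (p +ₚ r)
  length-+ₚʳ []      r       = ℕₚ.≤-refl
  length-+ₚʳ (a ∷ p) []      = z≤n
  length-+ₚʳ (a ∷ p) (b ∷ r) = s≤s (length-+ₚʳ p r)

  length-*ₚ : ∀ a p r → length p ℕ.+ length r ≤ length ((a ∷ p) *ₚ r)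
  length-*ₚ a []      r = ℕₚ.≤-trans (ℕₚ.≤-reflexive (≡.sym (length-scaleₚ a r))) (length-+ₚˡ (scaleₚ a r) _)
  length-*ₚ a (b ∷ p) r = ℕₚ.≤-trans (s≤s (length-*ₚ b p r)) (length-+ₚʳ (scaleₚ a r) _)

  -- This ensures that the division defining `qbinom` runs long enough: its numerator has x factors
  -- of length at least y + 1, hence length above x * y, and by `coeff-G` the quotient has no
  -- coefficient beyond x * y.
  length-prodₚ : ∀ x y f → (∀ i → i ≤ x → suc y ≤ length (f i)) → suc (x ℕ.* y) ≤ length (prodₚ x f)
  length-prodₚ zero    y f f-long = ℕₚ.≤-refl
  length-prodₚ (suc x) y f f-long with prodₚ x f | length-prodₚ x y f (λ i i≤x → f-long i (ℕₚ.m≤n⇒m≤1+n i≤x))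
  ... | a ∷ p | s≤s xy≤ = ℕₚ.≤-trans
    (ℕₚ.≤-trans (ℕₚ.≤-reflexive (≡.trans (cong suc (ℕₚ.+-comm y (x ℕ.* y))) (≡.sym (ℕₚ.+-suc (x ℕ.* y) y))))
      (ℕₚ.+-mono-≤ xy≤ (f-long (suc x) ℕₚ.≤-refl)))
    (length-*ₚ a p (f (suc x)))

  length-oneMinusQ : ∀ n → suc n ≤ length (oneMinusQ n)
  length-oneMinusQ n = ℕₚ.≤-trans (ℕₚ.≤-reflexive (≡.sym lengths)) (length-+ₚʳ oneₚ (negₚ (qpow n)))
    where
    lengths : length (negₚ (qpow n)) ≡ suc n
    lengths = ≡.trans (length-scaleₚ _ (qpow n)) (≡.trans (Listₚ.length-++ (replicate n (+ 0)))
      (≡.trans (cong (ℕ._+ 1) (Listₚ.length-replicate n)) (ℕₚ.+-comm n 1)))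

  coeff-shiftₚ : ∀ n p {i} → n ≤ i → coeff (shiftₚ n p) i ≡ coeff p (i ∸ n)
  coeff-shiftₚ zero    p n≤i       = refl
  coeff-shiftₚ (suc n) p (s≤s n≤i) = coeff-shiftₚ n p n≤i

  coeff-G : ∀ x y {i} → x ℕ.* y < i → coeff (G x y) i ≡ + 0
  coeff-G zero    y       {suc i} d<i = refl
  coeff-G (suc x) zero    {suc i} d<i = refl
  coeff-G (suc x) (suc y) {i}     d<i = ≡.trans (coeff-+ₚ (G x (suc y)) _ i) (cong₂ ℤ._+_
    (coeff-G x (suc y) (ℕₚ.≤-<-trans (ℕₚ.m≤n+m _ (suc y)) d<i))
    (≡.trans (≡.sym (at (shiftₚ≋ (suc x) (G (suc x) y)) i)) (≡.trans (coeff-shiftₚ (suc x) _ x<i)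
      (coeff-G (suc x) y (ℕₚ.+-cancelˡ-< (suc x) _ _ (≡.subst (suc x ℕ.+ suc x ℕ.* y <_) (≡.sym (ℕₚ.m+[n∸m]≡n x<i)) d<i′))))))
    where
    d<i′ : suc x ℕ.+ suc x ℕ.* y < i
    d<i′ = ≡.subst (_< i) (ℕₚ.*-suc (suc x) y) d<i
    x<i : suc x ≤ i
    x<i = ℕₚ.≤-trans (ℕₚ.m≤m+n (suc x) _) (ℕₚ.<⇒≤ d<i′)

  prodₚ-oneMinusQ : ∀ x → prodₚ x (λ i → oneMinusQ i) ≋ φ x
  prodₚ-oneMinusQ zero    = ≋-refl
  prodₚ-oneMinusQ (suc x) = *-cong (prodₚ-oneMinusQ x) (oneMinusQ≋ (suc x))

  coeff₀-prodₚ : ∀ x → coeff (prodₚ x (λ i → oneMinusQ i)) 0 ≡ + 1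
  coeff₀-prodₚ zero    = refl
  coeff₀-prodₚ (suc x) = ≡.trans (coeff₀-*ₚ (prodₚ x (λ i → oneMinusQ i)) (oneMinusQ (suc x))) (cong (ℤ._* + 1) (coeff₀-prodₚ x))

  Π-numerator : ∀ x y → Π x (λ i → oneMinusQ (suc (x ℕ.+ y) ∸ i)) *ₚ φ y ≋ φ (x ℕ.+ y)
  Π-numerator zero    y = *-identityˡ (φ y)
  Π-numerator (suc x) y = begin
    Π (suc x) f *ₚ φ y                                ≈⟨ *-congʳ {φ y} (Π-peel x f) ⟩
    f 1 *ₚ Π x (λ i → f (suc i)) *ₚ φ y               ≈⟨ *-assoc (f 1) (Π x (λ i → f (suc i))) (φ y) ⟩
    f 1 *ₚ (Π x (λ i → f (suc i)) *ₚ φ y)             ≈⟨ *-cong (oneMinusQ≋ (suc (x ℕ.+ y))) (Π-numerator x y) ⟩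
    (oneₚ -ₚ X ^ suc (x ℕ.+ y)) *ₚ φ (x ℕ.+ y)        ≈⟨ *-comm _ (φ (x ℕ.+ y)) ⟩
    φ (suc (x ℕ.+ y))                                 ∎
    where
    f : ℕ → Poly
    f i = oneMinusQ (suc (suc x ℕ.+ y) ∸ i)

  qbinom≋G : ∀ x y → qbinom (x ℕ.+ y) x ≋ G x y
  qbinom≋G x y = divₚ-exact numerator (prodₚ x (λ i → oneMinusQ i)) (G x y) (coeff₀-prodₚ x)
    (≋-trans (*-congʳ (prodₚ-oneMinusQ x)) (numerator-lemma {x} {y}
      (≋-trans (*-congʳ (reflexive (prodₚ≡Π x _))) (Π-numerator x y))))
    (λ i l≤i → coeff-G x y (ℕₚ.<-≤-trans (length-prodₚ x y _ factor-long) l≤i))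
    where
    numerator = prodₚ x (λ i → oneMinusQ (suc (x ℕ.+ y) ∸ i))
    factor-long : ∀ i → i ≤ x → suc y ≤ length (oneMinusQ (suc (x ℕ.+ y) ∸ i))
    factor-long i i≤x = ℕₚ.≤-trans (s≤s (ℕₚ.≤-trans (ℕₚ.≤-reflexive (≡.sym (ℕₚ.m+n∸m≡n x y))) (ℕₚ.∸-mono (ℕₚ.n≤1+n (x ℕ.+ y)) i≤x)))
      (length-oneMinusQ _)

  qbinomℤ-negative : ∀ n {i} → 0 < i → qbinomℤ n (ℤ.- (+ i)) ≡ []
  qbinomℤ-negative n {suc i} _ = refl

  -- Here k > a does occur: k runs up to n 1, which may exceed other entries of the cycle. Both
  -- sides are then 0, by the convention for negative lower entries and by the design of `G∸`.
  qbinomℤ≋β : ∀ a b k → qbinomℤ (a ℕ.+ b ℕ.+ 1) ((+ a) ℤ.- (+ k)) ≋ β a b k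
  qbinomℤ≋β a b k with k ℕ.≤? a
  ... | yes k≤a = begin
    qbinomℤ (a ℕ.+ b ℕ.+ 1) ((+ a) ℤ.- (+ k))   ≡⟨ cong (qbinomℤ _) (≡.trans (ℤₚ.m-n≡m⊖n a k) (ℤₚ.⊖-≥ k≤a)) ⟩
    qbinom (a ℕ.+ b ℕ.+ 1) (a ∸ k)              ≡⟨ cong (λ i → qbinom i (a ∸ k)) index ⟩
    qbinom (a ∸ k ℕ.+ suc (b ℕ.+ k)) (a ∸ k)    ≈⟨ qbinom≋G (a ∸ k) (suc (b ℕ.+ k)) ⟩
    G (a ∸ k) (suc (b ℕ.+ k))                   ≡⟨ G∸-∸ _ k≤a ⟨
    β a b k                                     ∎
    where
    open Data.Nat.Solver.+-*-Solver
    index : a ℕ.+ b ℕ.+ 1 ≡ a ∸ k ℕ.+ suc (b ℕ.+ k)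
    index = ≡.trans (cong (λ i → i ℕ.+ b ℕ.+ 1) (≡.sym (ℕₚ.m∸n+n≡m k≤a)))
      (solve 3 (λ v k b → v :+ k :+ b :+ con 1 := v :+ (con 1 :+ (b :+ k))) refl (a ∸ k) k b)
  ... | no k≰a = reflexive (≡.trans
    (cong (qbinomℤ n) (≡.trans (ℤₚ.m-n≡m⊖n a k) (ℤₚ.⊖-≰ k≰a)))
    (≡.trans (qbinomℤ-negative n (ℕₚ.m<n⇒0<n∸m (ℕₚ.≰⇒> k≰a))) (≡.sym (G∸-< _ (ℕₚ.≰⇒> k≰a)))))
    where
    n = a ℕ.+ b ℕ.+ 1

  -- Laurent polynomials

  Clearedₗ : ℕ → Laurent → Poly → Set
  Clearedₗ N (s , p) x = Cleared N s p x

  qpowℤ-cleared : ∀ a b → Clearedₗ b (qpowℤ ((+ a) ℤ.- (+ b))) (X ^ a)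
  qpowℤ-cleared a b with b ℕ.≤? a
  ... | yes b≤a rewrite ≡.trans (ℤₚ.m-n≡m⊖n a b) (ℤₚ.⊖-≥ b≤a) = cleared (begin
    X ^ b *ₚ qpow (a ∸ b)     ≈⟨ *-congˡ {X ^ b} (qpow≋ (a ∸ b)) ⟩
    X ^ b *ₚ X ^ (a ∸ b)      ≈⟨ q^-+ b (a ∸ b) ⟨
    X ^ (b ℕ.+ (a ∸ b))       ≡⟨ cong (X ^_) (ℕₚ.m+[n∸m]≡n b≤a) ⟩
    X ^ a                     ≈⟨ *-identityˡ (X ^ a) ⟨
    oneₚ *ₚ X ^ a             ∎)
  ... | no b≰a rewrite ≡.trans (ℤₚ.m-n≡m⊖n a b) (ℤₚ.⊖-≰ b≰a) =
    negative (b ∸ a) (ℕₚ.m<n⇒0<n∸m (ℕₚ.≰⇒> b≰a)) (ℕₚ.m∸n+n≡m (ℕₚ.≰⇒≥ b≰a))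
    where
    negative : ∀ i → 0 < i → i ℕ.+ a ≡ b → Clearedₗ b (qpowℤ (ℤ.- (+ i))) (X ^ a)
    negative (suc i) _ refl = cleared (≋-trans (*-identityʳ _) (q^-+ (suc i) a))

  Clearedₗ-+ : ∀ {N} A B {x y} → Clearedₗ N A x → Clearedₗ N B y → Clearedₗ N (A +ₗ B) (x +ₚ y)
  Clearedₗ-+ (s , p) (t , r) c d = Cleared-cong
    (+-cong (≋-sym (shiftₚ≋ (s ℕ.⊔ t ∸ s) p)) (≋-sym (shiftₚ≋ (s ℕ.⊔ t ∸ t) r))) ≋-refl (Cleared-+ c d)

  Clearedₗ-sum : ∀ N n {f g} → (∀ k → k ≤ n → Clearedₗ N (f k) (g k)) → Clearedₗ N (sumₗ n f) (Σ≤ n g)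
  Clearedₗ-sum N zero    e = e 0 z≤n
  Clearedₗ-sum N (suc n) {f} e = Clearedₗ-+ (sumₗ n f) (f (suc n))
    (Clearedₗ-sum N n λ k k≤n → e k (ℕₚ.m≤n⇒m≤1+n k≤n)) (e (suc n) ℕₚ.≤-refl)

  Clearedₗ-** : ∀ {N} A {x} u v {u′ v′} → u ≋ u′ → v ≋ v′ → Clearedₗ N A x →
    Clearedₗ N (A *ₗ fromPoly u *ₗ fromPoly v) (x *ₚ u′ *ₚ v′)
  Clearedₗ-** {N} (s , p) {x} u v u≋u′ v≋v′ c = ≡.subst (λ i → Cleared N i (p *ₚ u *ₚ v) _)
    (≡.sym (≡.trans (ℕₚ.+-identityʳ _) (ℕₚ.+-identityʳ s)))
    (Cleared-cong ≋-refl (*-cong (*-congˡ {x} u≋u′) v≋v′) (Cleared-** u v c))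

  Clearedₗ-scale : ∀ {N} c A {x y} → (c ∷ []) ≋ y → Clearedₗ N A x → Clearedₗ N (scaleₗ c A) (y *ₚ x)
  Clearedₗ-scale c (s , p) {x} c≋y d = Cleared-cong (const-*ₚ c p) (*-congʳ c≋y) (Cleared-*ˡ (c ∷ []) d)

  -- The equation in `Cleared` has the shape of the divisibility condition, so N and y are the
  -- witnesses themselves. Subtracting `zeroₗ` changes the representation of A, so the clearing is
  -- redone for the difference.
  Clearedₗ⇒≡0 : ∀ {N D} A {x} y → Clearedₗ N A x → x ≋ D *ₚ y → A ≡ zeroₗ mod D
  Clearedₗ⇒≡0 {N} {D} A {x} y c x≋Dy = N , y , at (begin
    shiftₚ N (proj₂ A₀)                  ≈⟨ shiftₚ≋ N (proj₂ A₀) ⟩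
    X ^ N *ₚ proj₂ A₀                    ≈⟨ Cleared.clear (Clearedₗ-+ A zeroₗ c zero-cleared) ⟩
    X ^ proj₁ A₀ *ₚ (x +ₚ [])            ≈⟨ *-congˡ {X ^ proj₁ A₀} (≋-trans (+ₚ-identityʳ x) x≋Dy) ⟩
    X ^ proj₁ A₀ *ₚ (D *ₚ y)             ≈⟨ shiftₚ≋ (proj₁ A₀) (D *ₚ y) ⟨
    shiftₚ (proj₁ A₀) (D *ₚ y)           ∎)
    where
    A₀ = A +ₗ scaleₗ (ℤ.- (+ 1)) zeroₗ
    zero-cleared : Clearedₗ N zeroₗ []
    zero-cleared = cleared (≋-trans (zeroʳ (X ^ N)) (≋-sym (zeroʳ oneₚ)))

  sgn≋ : ∀ k → ((ℤ.- (+ 1)) ℤ.^ k ∷ []) ≋ sgn k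
  sgn≋ zero    = ≋-refl
  sgn≋ (suc k) = scaleₚ-cong refl (sgn≋ k)

  modulus≋M : ∀ a b → qint (a ℕ.+ b ℕ.+ 1) *ₚ qbinom (a ℕ.+ b) a ≋ M a b
  modulus≋M a b = *-cong (≋-trans (qint≋ (a ℕ.+ b ℕ.+ 1)) (reflexive (cong [_] (ℕₚ.+-comm (a ℕ.+ b) 1)))) (qbinom≋G a b)

  Πqbinom≋Πβ : ∀ m n k → prodₚ m (λ i → qbinomℤ (n i ℕ.+ n (suc i) ℕ.+ 1) ((+ n i) ℤ.- (+ k))) ≋ Πβ m n k
  Πqbinom≋Πβ m n k = ≋-trans (reflexive (prodₚ≡Π m _)) (Π-cong m λ i → qbinomℤ≋β (n i) (n (suc i)) k)

  -- The odd power is split into the r squares supplied by `Good-[2k+1]^` and the single factor that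
  -- belongs to the base weight.
  qint^≋ : ∀ r k → qint (2 ℕ.* k ℕ.+ 1) ^ₚ (2 ℕ.* r ℕ.+ 1) ≋ [2k+1] k ^ (r ℕ.* 2) *ₚ [2k+1] k
  qint^≋ r k = begin
    qint (2 ℕ.* k ℕ.+ 1) ^ₚ (2 ℕ.* r ℕ.+ 1)
      ≡⟨ ^ₚ≡^ _ (2 ℕ.* r ℕ.+ 1) ⟩
    qint (2 ℕ.* k ℕ.+ 1) ^ (2 ℕ.* r ℕ.+ 1)
      ≡⟨ cong₂ (λ i j → qint i ^ j)
           (solve 1 (λ k → con 2 :* k :+ con 1 := con 1 :+ (k :+ k)) refl k)
           (solve 1 (λ r → con 2 :* r :+ con 1 := con 1 :+ r :* con 2) refl r) ⟩
    qint (suc (k ℕ.+ k)) ^ suc (r ℕ.* 2)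
      ≈⟨ ^-congˡ (suc (r ℕ.* 2)) (qint≋ (suc (k ℕ.+ k))) ⟩
    [2k+1] k ^ suc (r ℕ.* 2)
      ≈⟨ *-comm ([2k+1] k) _ ⟩
    [2k+1] k ^ (r ℕ.* 2) *ₚ [2k+1] k ∎
    where open Data.Nat.Solver.+-*-Solver

  -- Clearing negative powers of q from the summands of the theorem

  factors : (ℕ → ℕ) → ℕ → ℕ → Poly
  factors n m k = prodₚ m (λ i → qbinomℤ (n i ℕ.+ n (suc i) ℕ.+ 1) ((+ n i) ℤ.- (+ k)))

  -- Two names for one exponent: `e` has the form in which the theorem writes it, `e′` the form that
  -- the construction of the good weight produces.
  summand-cleared : ∀ e e′ n m r a k → e ≡ e′ → k ≤ n 1 →
    Clearedₗ (e ℕ.* n 1)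
      (qpowℤ ((+ a) ℤ.- (+ (e ℕ.* k))) *ₗ fromPoly (qint (2 ℕ.* k ℕ.+ 1) ^ₚ (2 ℕ.* r ℕ.+ 1)) *ₗ fromPoly (factors n m k))
      (X ^ (e′ ℕ.* (n 1 ∸ k)) *ₚ (X ^ a *ₚ ([2k+1] k ^ (r ℕ.* 2) *ₚ [2k+1] k) *ₚ Πβ m n k))
  summand-cleared e e′ n m r a k refl k≤n = ≡.subst (λ N → Clearedₗ N term (X ^ (e ℕ.* (n 1 ∸ k)) *ₚ value)) exponent
    (Cleared-raise (e ℕ.* (n 1 ∸ k)) (Clearedₗ-** monomial (qint (2 ℕ.* k ℕ.+ 1) ^ₚ (2 ℕ.* r ℕ.+ 1)) (factors n m k)
      (qint^≋ r k) (Πqbinom≋Πβ m n k) (qpowℤ-cleared a (e ℕ.* k))))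
    where
    monomial term : Laurent
    monomial = qpowℤ ((+ a) ℤ.- (+ (e ℕ.* k)))
    term     = monomial *ₗ fromPoly (qint (2 ℕ.* k ℕ.+ 1) ^ₚ (2 ℕ.* r ℕ.+ 1)) *ₗ fromPoly (factors n m k)
    value : Poly
    value = X ^ a *ₚ ([2k+1] k ^ (r ℕ.* 2) *ₚ [2k+1] k) *ₚ Πβ m n k
    exponent : e ℕ.* k ℕ.+ e ℕ.* (n 1 ∸ k) ≡ e ℕ.* n 1
    exponent = ≡.trans (≡.sym (ℕₚ.*-distribˡ-+ e k (n 1 ∸ k))) (cong (e ℕ.*_) (ℕₚ.m+[n∸m]≡n k≤n))

  signed-summand-cleared : ∀ e e′ n m r i j k → e ≡ e′ → k ≤ n 1 →
    Clearedₗ (e ℕ.* n 1)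
      (scaleₗ ((ℤ.- (+ 1)) ℤ.^ k) (qpowℤ ((+ (i ℕ.+ j)) ℤ.- (+ (e ℕ.* k))) *ₗ fromPoly (qint (2 ℕ.* k ℕ.+ 1) ^ₚ (2 ℕ.* r ℕ.+ 1)) *ₗ fromPoly (factors n m k)))
      (X ^ (e′ ℕ.* (n 1 ∸ k)) *ₚ (X ^ j *ₚ ([2k+1] k ^ (r ℕ.* 2) *ₚ (sgn k *ₚ X ^ i *ₚ [2k+1] k)) *ₚ Πβ m n k))
  signed-summand-cleared e e′ n m r i j k e≡e′ k≤n = Cleared-cong ≋-refl
    (sgn-inside i j k ([2k+1] k ^ (r ℕ.* 2)) ([2k+1] k) (X ^ (e′ ℕ.* (n 1 ∸ k))) (Πβ m n k))
    (Clearedₗ-scale ((ℤ.- (+ 1)) ℤ.^ k) (qpowℤ ((+ (i ℕ.+ j)) ℤ.- (+ (e ℕ.* k))) *ₗ fromPoly (qint (2 ℕ.* k ℕ.+ 1) ^ₚ (2 ℕ.* r ℕ.+ 1)) *ₗ fromPoly (factors n m k))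
      (sgn≋ k) (summand-cleared e e′ n m r (i ℕ.+ j) k e≡e′ k≤n))

  divisible : ∀ a b {N x} A y → Clearedₗ N A x → x ≋ M a b *ₚ y → A ≡ zeroₗ mod (qint (a ℕ.+ b ℕ.+ 1) *ₚ qbinom (a ℕ.+ b) a)
  divisible a b A y c x≋ = Clearedₗ⇒≡0 {D = qint (a ℕ.+ b ℕ.+ 1) *ₚ qbinom (a ℕ.+ b) a} A y c
    (≋-trans x≋ (*-congʳ (≋-sym (modulus≋M a b))))

open import Data.Nat using (_+_; _*_)

theorem1p1 : (m : ℕ) → 1 ≤ m → (n : ℕ → ℕ)
    → (∀ i → 1 ≤ i → i ≤ m → 1 ≤ n i)
    → n (suc m) ≡ n 1
    → (j r : ℕ) → j ≤ m
    → (sumₗ (n 1) (λ k →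
    qpowℤ ((+ (j * (k * k + k))) ℤ.- (+ ((2 * r + 1) * k)))
    *ₗ fromPoly (qint (2 * k + 1) ^ₚ (2 * r + 1))
    *ₗ fromPoly (prodₚ m (λ i → qbinomℤ (n i + n (suc i) + 1) ((+ n i) ℤ.- (+ k)))))
    ≡ zeroₗ mod (qint (n 1 + n m + 1) *ₚ qbinom (n 1 + n m) (n 1)))
    × (sumₗ (n 1) (λ k →
    scaleₗ ((ℤ.- (+ 1)) ℤ.^ k)
    (qpowℤ ((+ (k C 2 + j * (k * k + k))) ℤ.- (+ (2 * r * k)))
    *ₗ fromPoly (qint (2 * k + 1) ^ₚ (2 * r + 1))
    *ₗ fromPoly (prodₚ m (λ i → qbinomℤ (n i + n (suc i) + 1) ((+ n i) ℤ.- (+ k))))))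
    ≡ zeroₗ mod (qint (n 1 + n m + 1) *ₚ qbinom (n 1 + n m) (n 1)))
theorem1p1 (suc m) _ n _ closed j r _ = first , second
  where
  open PolynomialQSeries

  first = let Y , Σ≋ = Good⇒cycle (Good-q^j[k²+k] j (Good-[2k+1]^ r Good-base)) m n closed in
    divisible (n 1) (n (suc m)) _ Y
      -- The negative exponent (2r+1)k is largest at k = n 1, so this power of q clears every
      -- summand.
      (Clearedₗ-sum ((2 * r + 1) * n 1) (n 1) λ k →
        summand-cleared (2 * r + 1) (r * 2 + 1) n (suc m) r (j * (k * k + k)) k (cong (_+ 1) (ℕₚ.*-comm 2 r)))
      Σ≋

  second = let Y , Σ≋ = Good⇒cycle (Good-q^j[k²+k] j (Good-[2k+1]^ r Good-base-alternating)) m n closed in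
    divisible (n 1) (n (suc m)) _ Y
      (Clearedₗ-sum (2 * r * n 1) (n 1) λ k →
        signed-summand-cleared (2 * r) (r * 2 + 0) n (suc m) r (k C 2) (j * (k * k + k)) k
          (≡.trans (ℕₚ.*-comm 2 r) (≡.sym (ℕₚ.+-identityʳ _))))
      Σ≋
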